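{- Let $M$ be a matroid and let $\mathcal{Z}(M)$ be its lattice of cyclic flats. Suppose that (a) $\mathcal{Z}(M)$ has dimension at most two, and (b) for each antichain $\mathcal{A}$ of $\mathcal{Z}(M)$, the sublattice of $\mathcal{Z}(M)$ generated by $\mathcal{A}$ is distributive. Then $M$ and all of its minors, as well as the duals of all of these matroids, are transversal.
   Context: All matroids are finite. A flat $X$ of a matroid $M$ is cyclic if the restriction $M|X$ has no isthmuses (equivalently, $X$ is a union of circuits). The cyclic flats of $M$, ordered by inclusion, form a (finite) lattice $\mathcal{Z}(M)$; in it, $A\lor B=\mathrm{cl}(A\cup B)$, and $A\land B$ is the union of the circuits contained in $A\cap B$. The dimension of an ordered set $P$ is the least number of chains whose product contains an order-embedding of $P$. An antichain is a set of pairwise incomparable elements. -}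

module Defs where

open import Level using (0ℓ)
open import Data.Nat using (ℕ; _<_; _≤_; _+_)
open import Data.Fin using (Fin)
open import Data.Fin.Subset
  using (Subset; _∈_; _∉_; _⊆_; _⊂_; _∪_; _∩_; ∁; ⁅_⁆; ⊥; ⊤; ∣_∣; Empty)
open import Data.Product using (Σ; ∃; _×_; _,_)
open import Relation.Nullary using (¬_)
open import Relation.Unary using (Decidable; Pred)
open import Relation.Binary.PropositionalEquality using (_≡_)
open import Relation.Binary.Bundles using (TotalOrder)
open import Function.Bundles using (_⇔_)

record Matroid (n : ℕ) : Set₁ where
  field
    Indep       : Subset n → Set
    Indep?      : Decidable Indep
    empty-indep : Indep ⊥
    hereditary  : ∀ {I J} → J ⊆ I → Indep I → Indep J
    augment     : ∀ {I J} → Indep I → Indep J → ∣ I ∣ < ∣ J ∣ →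
                  ∃ λ e → e ∈ J × e ∉ I × Indep (I ∪ ⁅ e ⁆)

MaxIn : ∀ {n} → (Subset n → Set) → Subset n → Subset n → Set
MaxIn Ind X B = B ⊆ X × Ind B × (∀ J → J ⊆ X → Ind J → B ⊆ J → B ≡ J)

module _ {n : ℕ} (M : Matroid n) where
  open Matroid M

  HasRank : Subset n → ℕ → Set
  HasRank X k = (∃ λ I → I ⊆ X × Indep I × ∣ I ∣ ≡ k)
              × (∀ J → J ⊆ X → Indep J → ∣ J ∣ ≤ k)

  InClosure : Subset n → Fin n → Set
  InClosure X e = ∀ k → HasRank X k → HasRank (X ∪ ⁅ e ⁆) k

  Flat : Subset n → Set
  Flat X = ∀ e → InClosure X e → e ∈ X

  IsthmusOf : Subset n → Fin n → Set
  IsthmusOf X e = e ∈ X × (∀ B → MaxIn Indep X B → e ∈ B)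

  Cyclic : Subset n → Set
  Cyclic X = ∀ e → ¬ IsthmusOf X e

  CyclicFlat : Subset n → Set
  CyclicFlat X = Flat X × Cyclic X

  Circuit : Subset n → Set
  Circuit C = ¬ Indep C × (∀ D → D ⊂ C → Indep D)

  -- Lattice operations of Z(M), as (functional) relations:
  -- Z is A ∨ B = cl(A ∪ B)
  IsJoin : Subset n → Subset n → Subset n → Set
  IsJoin A B Z = ∀ e → (e ∈ Z ⇔ InClosure (A ∪ B) e)

  IsMeet : Subset n → Subset n → Subset n → Set
  IsMeet A B Z = ∀ e → (e ∈ Z ⇔ (∃ λ C → Circuit C × e ∈ C × C ⊆ (A ∩ B)))

  DimAtMost2 : Set₁
  DimAtMost2 =
    Σ (TotalOrder 0ℓ 0ℓ 0ℓ) λ C₁ → Σ (TotalOrder 0ℓ 0ℓ 0ℓ) λ C₂ →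
    Σ (Subset n → TotalOrder.Carrier C₁) λ f →
    Σ (Subset n → TotalOrder.Carrier C₂) λ g →
      ∀ X Y → CyclicFlat X → CyclicFlat Y →
        (X ⊆ Y ⇔ (TotalOrder._≤_ C₁ (f X) (f Y) × TotalOrder._≤_ C₂ (g X) (g Y)))

  Antichain : Pred (Subset n) 0ℓ → Set
  Antichain 𝒜 = (∀ X → 𝒜 X → CyclicFlat X)
              × (∀ X Y → 𝒜 X → 𝒜 Y → X ⊆ Y → X ≡ Y)

  data Generated (𝒜 : Pred (Subset n) 0ℓ) : Subset n → Set where
    gen  : ∀ {X} → 𝒜 X → Generated 𝒜 X
    join : ∀ {X Y Z} → Generated 𝒜 X → Generated 𝒜 Y → IsJoin X Y Z → Generated 𝒜 Z
    meet : ∀ {X Y Z} → Generated 𝒜 X → Generated 𝒜 Y → IsMeet X Y Z → Generated 𝒜 Z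

  DistributiveGen : Pred (Subset n) 0ℓ → Set
  DistributiveGen 𝒜 = ∀ X Y Z → Generated 𝒜 X → Generated 𝒜 Y → Generated 𝒜 Z →
    ∀ YZ L XY XZ R → IsJoin Y Z YZ → IsMeet X YZ L →
      IsMeet X Y XY → IsMeet X Z XZ → IsJoin XY XZ R → L ≡ R

record SetSystem (n : ℕ) : Set₁ where
  field
    ground : Subset n
    indep  : Subset n → Set
open SetSystem public

-- the minor M / C \ D (C, D disjoint)
minor : ∀ {n} → Matroid n → Subset n → Subset n → SetSystem n
minor M C D = record
  { ground = ∁ (C ∪ D)
  ; indep  = λ I → I ⊆ ∁ (C ∪ D) ×
                   (∃ λ B → MaxIn (Matroid.Indep M) C B × Matroid.Indep M (I ∪ B))
  }

Basis : ∀ {n} → SetSystem n → Subset n → Set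
Basis S B = MaxIn (indep S) (ground S) B

dual : ∀ {n} → SetSystem n → SetSystem n
dual S = record
  { ground = ground S
  ; indep  = λ I → I ⊆ ground S × (∃ λ B → Basis S B × Empty (I ∩ B))
  }

PartialTransversal : ∀ {n k} → (Fin k → Subset n) → Subset n → Set
PartialTransversal {n} {k} A I = ∃ λ (φ : Fin n → Fin k) →
  (∀ e → e ∈ I → e ∈ A (φ e)) ×
  (∀ e e′ → e ∈ I → e′ ∈ I → φ e ≡ φ e′ → e ≡ e′)

Transversal : ∀ {n} → SetSystem n → Set
Transversal {n} S = ∃ λ (k : ℕ) → Σ (Fin k → Subset n) λ A →
  (∀ i → A i ⊆ ground S) ×
  (∀ I → (indep S I ⇔ (I ⊆ ground S × PartialTransversal A I)))

{-# OPTIONS --safe #-}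

-- A matroid is transversal as soon as one can choose multiplicities on its cyclic flats F so
-- that, for each cyclic flat A, exactly r(E) − r(A) of the chosen flats contain A: the complements
-- of the chosen flats then form a presentation, by Hall's theorem.  The multiplicities are forced
-- (work downwards from the large flats); they are nonnegative, and Hall's condition holds, as soon as
-- for every antichain A₁, …, Aₖ of cyclic flats the number of chosen flats containing some Aᵢ is at
-- most r(E) − r(A₁ ∩ … ∩ Aₖ).  In dimension two the antichain can be ordered so that
-- Aᵢ ∧ Aₗ ⊆ Aⱼ ⊆ Aᵢ ∨ Aₗ for i < j < l, and the bound follows by adding one Aᵢ at a time: the
-- submodular inequality needed is A₂ ⊆ cl(A₁ ∪ (A₂ ∩ … ∩ Aₖ)), which is distributivity of the
-- lattice generated by A₁, A₂, Aₖ.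
--
-- Deletions preserve transversality, so only contractions M/X and M*/X matter.  For these the same
-- argument runs with the flats cl(G ∪ X), G a cyclic flat of M (or of M*): the inclusions above
-- survive adjoining X.
module Submission where

open import Defs
open import Level using (0ℓ)
open import Data.Bool using (true; false)
open import Data.Empty using (⊥-elim)
open import Data.Fin using (Fin; zero; suc; _≟_)
open import Data.Fin.Properties using (any?)
open import Data.Fin.Subset using (Subset; inside; outside; _∈_; _∉_; _⊆_; _⊈_; _∪_; _∩_; _─_; _-_; ∁; ⁅_⁆; ⊥; ⊤; ∣_∣; Empty; Nonempty)
open import Data.Fin.Subset.Properties
open import Data.List using (List; []; _∷_; _++_; allFin; lookup; filter; replicate; length; foldr; map)
import Data.List.Membership.Propositional as List
open import Data.List.Membership.Propositional.Properties using (∈-allFin; ∈-filter⁺; ∈-filter⁻; ∈-lookup; ∈-++⁻; ∈-++⁺ˡ; ∈-++⁺ʳ; ∈-map⁺)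
import Data.List.Relation.Binary.Permutation.Propositional as Perm
import Data.List.Relation.Binary.Permutation.Propositional.Properties as Permₚ
open import Data.List.Relation.Unary.All as All using (All; []; _∷_)
import Data.List.Relation.Unary.All.Properties as All
open import Data.List.Relation.Unary.AllPairs using (AllPairs; []; _∷_)
import Data.List.Relation.Unary.AllPairs.Properties as AllPairs
open import Data.List.Relation.Unary.Any as Any using (Any; here; there)
open import Data.List.Relation.Unary.Any.Properties using (lookup-index)
open import Data.List.Relation.Unary.Linked.Properties using (Linked⇒AllPairs)
import Data.List.Sort as Sort
open import Data.Nat using (ℕ; zero; suc; _+_; _∸_; _≤_; _<_; s≤s; z≤n; _≤?_; _<?_)
open import Data.Nat.Properties hiding (_≟_)
open import Data.Nat.Tactic.RingSolver using (solve-∀)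
open import Data.Product using (∃; Σ; _×_; _,_; proj₁; proj₂)
open import Data.Sum using (_⊎_; inj₁; inj₂; [_,_]′)
open import Data.Vec using ([]; _∷_; tabulate; there)
open import Data.Vec.Properties using (lookup∘tabulate; lookup⇒[]=; []=⇒lookup)
open import Function using (_∘_; id; _⇔_; mk⇔; Equivalence)
open import Relation.Binary.Bundles using (TotalOrder)
import Relation.Binary.Construct.On as On
open import Relation.Binary.PropositionalEquality using (_≡_; _≢_; refl; sym; trans; cong; cong₂; subst; module ≡-Reasoning)
open import Relation.Nullary using (¬_; Dec; yes; no; does; contradiction)
open import Relation.Nullary.Decidable using (_×-dec_; ¬?; dec-true; dec-false; decidable-stable)
open import Relation.Unary using (Pred; Decidable)

-- Finite subsets

setOf : ∀ {n ℓ} {P : Pred (Fin n) ℓ} → Decidable P → Subset n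
setOf P? = tabulate (does ∘ P?)

∈-setOf⁺ : ∀ {n ℓ} {P : Pred (Fin n) ℓ} (P? : Decidable P) {x} → P x → x ∈ setOf P?
∈-setOf⁺ P? {x} px =
  lookup⇒[]= x _ (trans (lookup∘tabulate (does ∘ P?) x) (dec-true (P? x) px))

∈-setOf⁻ : ∀ {n ℓ} {P : Pred (Fin n) ℓ} (P? : Decidable P) {x} → x ∈ setOf P? → P x
∈-setOf⁻ P? {x} x∈ with P? x | trans (sym (lookup∘tabulate (does ∘ P?) x)) ([]=⇒lookup x∈)
... | yes px | _ = px
... | no  _  | ()

module _ {n : ℕ} where

  private variable
    p q s : Subset n
    x     : Fin n

  ∪-split : x ∈ p ∪ q → x ∈ p ⊎ x ∈ q
  ∪-split = x∈p∪q⁻ _ _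

  ∪-inl : p ⊆ p ∪ q
  ∪-inl {q = q} = p⊆p∪q q

  ∪-inr : q ⊆ p ∪ q
  ∪-inr {p = p} = q⊆p∪q p _

  ∪-lub : p ⊆ s → q ⊆ s → p ∪ q ⊆ s
  ∪-lub f g = [ f , g ]′ ∘ ∪-split

  ∪-mono : ∀ {p′ q′ : Subset n} → p ⊆ p′ → q ⊆ q′ → p ∪ q ⊆ p′ ∪ q′
  ∪-mono f g = ∪-lub (∪-inl ∘ f) (∪-inr ∘ g)

  ∪-swap : p ∪ q ⊆ q ∪ p
  ∪-swap = ∪-lub ∪-inr ∪-inl

  ∩-prl : p ∩ q ⊆ p
  ∩-prl = p∩q⊆p _ _

  ∩-prr : p ∩ q ⊆ q
  ∩-prr = p∩q⊆q _ _

  ∩-glb : s ⊆ p → s ⊆ q → s ⊆ p ∩ q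
  ∩-glb f g z = x∈p∩q⁺ (f z , g z)

  ⁅⁆⊆ : x ∈ p → ⁅ x ⁆ ⊆ p
  ⁅⁆⊆ {x = x} {p = p} x∈p z = subst (_∈ p) (sym (x∈⁅y⁆⇒x≡y x z)) x∈p

  ∁-anti : p ⊆ q → ∁ q ⊆ ∁ p
  ∁-anti f = x∉p⇒x∈∁p ∘ (λ x∈∁q → x∈∁p⇒x∉p x∈∁q ∘ f)

  ∈-or-∈∁ : ∀ x (p : Subset n) → x ∈ p ⊎ x ∈ ∁ p
  ∈-or-∈∁ x p with x ∈? p
  ... | yes x∈p = inj₁ x∈p
  ... | no  x∉p = inj₂ (x∉p⇒x∈∁p x∉p)

x∈p─q⇒x∉q : ∀ {n} {x} (p q : Subset n) → x ∈ p ─ q → x ∉ q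
x∈p─q⇒x∉q (_ ∷ p) (inside  ∷ q) (there x∈) (there x∈q) = x∈p─q⇒x∉q p q x∈ x∈q
x∈p─q⇒x∉q (_ ∷ p) (outside ∷ q) (there x∈) (there x∈q) = x∈p─q⇒x∉q p q x∈ x∈q

module _ {n : ℕ} where

  private variable
    p q : Subset n
    x y : Fin n

  x∈p-y⇒x≢y : x ∈ p - y → x ≢ y
  x∈p-y⇒x≢y {p = p} {y = y} x∈ refl = x∈p─q⇒x∉q p ⁅ y ⁆ x∈ (x∈⁅x⁆ y)

  p-x⊆p : p - x ⊆ p
  p-x⊆p = p─q⊆p _ _

  -‿mono : p ⊆ q → p - x ⊆ q - x
  -‿mono f z = x∈p∧x≢y⇒x∈p-y (f (p-x⊆p z)) (x∈p-y⇒x≢y z)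

  ⊆- : p ⊆ q → x ∉ p → p ⊆ q - x
  ⊆- {p = p} f x∉p z = x∈p∧x≢y⇒x∈p-y (f z) λ z≡x → x∉p (subst (_∈ p) z≡x z)

  p⊆p-x∪⁅x⁆ : p ⊆ (p - x) ∪ ⁅ x ⁆
  p⊆p-x∪⁅x⁆ {x = x} {y} z with y ≟ x
  ... | yes refl = ∪-inr (x∈⁅x⁆ x)
  ... | no  y≢x  = ∪-inl (x∈p∧x≢y⇒x∈p-y z y≢x)

  ─∪-cover : p ⊆ (p ∩ q) ∪ (p ─ q)
  ─∪-cover {q = q} {x} z with x ∈? q
  ... | yes x∈q = ∪-inl (x∈p∩q⁺ (z , x∈q))
  ... | no  x∉q = ∪-inr (x∈p∧x∉q⇒x∈p─q z x∉q)

  ⊈⇒∃ : p ⊈ q → ∃ λ x → x ∈ p × x ∉ q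
  ⊈⇒∃ {p = p} {q = q} p⊈q with nonempty? (p ─ q)
  ... | yes (x , x∈) = x , p─q⊆p p q x∈ , x∈p─q⇒x∉q p q x∈
  ... | no  empty    = ⊥-elim (p⊈q incl)
    where
    incl : p ⊆ q
    incl {z} z∈p with z ∈? q
    ... | yes z∈q = z∈q
    ... | no  z∉q = contradiction (z , x∈p∧x∉q⇒x∈p─q z∈p z∉q) empty

∣p∪q∣+∣p∩q∣≡∣p∣+∣q∣ : ∀ {n} (p q : Subset n) → ∣ p ∪ q ∣ + ∣ p ∩ q ∣ ≡ ∣ p ∣ + ∣ q ∣
∣p∪q∣+∣p∩q∣≡∣p∣+∣q∣ [] [] = refl
∣p∪q∣+∣p∩q∣≡∣p∣+∣q∣ (outside ∷ p) (outside ∷ q) = ∣p∪q∣+∣p∩q∣≡∣p∣+∣q∣ p q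
∣p∪q∣+∣p∩q∣≡∣p∣+∣q∣ (inside  ∷ p) (outside ∷ q) = cong suc (∣p∪q∣+∣p∩q∣≡∣p∣+∣q∣ p q)
∣p∪q∣+∣p∩q∣≡∣p∣+∣q∣ (outside ∷ p) (inside  ∷ q) =
  trans (cong suc (∣p∪q∣+∣p∩q∣≡∣p∣+∣q∣ p q)) (sym (+-suc ∣ p ∣ ∣ q ∣))
∣p∪q∣+∣p∩q∣≡∣p∣+∣q∣ (inside  ∷ p) (inside  ∷ q) = cong suc
  (trans (+-suc ∣ p ∪ q ∣ ∣ p ∩ q ∣)
  (trans (cong suc (∣p∪q∣+∣p∩q∣≡∣p∣+∣q∣ p q)) (sym (+-suc ∣ p ∣ ∣ q ∣))))

module _ {n : ℕ} where

  private variable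
    p q : Subset n
    x   : Fin n

  ∣p∪q∣≤∣p∣+∣q∣ : ∀ (p q : Subset n) → ∣ p ∪ q ∣ ≤ ∣ p ∣ + ∣ q ∣
  ∣p∪q∣≤∣p∣+∣q∣ p q = ≤-trans (m≤m+n _ _) (≤-reflexive (∣p∪q∣+∣p∩q∣≡∣p∣+∣q∣ p q))

  ∣⊎∣ : ∀ (p q : Subset n) → (∀ {x} → x ∈ p → x ∉ q) → ∣ p ∪ q ∣ ≡ ∣ p ∣ + ∣ q ∣
  ∣⊎∣ p q disjoint = begin
    ∣ p ∪ q ∣              ≡⟨ +-identityʳ _ ⟨
    ∣ p ∪ q ∣ + 0          ≡⟨ cong (∣ p ∪ q ∣ +_) ∣p∩q∣≡0 ⟨
    ∣ p ∪ q ∣ + ∣ p ∩ q ∣  ≡⟨ ∣p∪q∣+∣p∩q∣≡∣p∣+∣q∣ p q ⟩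
    ∣ p ∣ + ∣ q ∣          ∎
    where
    open ≡-Reasoning
    ∣p∩q∣≡0 : ∣ p ∩ q ∣ ≡ 0
    ∣p∩q∣≡0 = trans
      (cong ∣_∣ (Empty-unique λ { (_ , z) → disjoint (∩-prl z) (∩-prr z) })) (∣⊥∣≡0 n)

  ∣p∣≡∣p∩q∣+∣p─q∣ : ∀ (p q : Subset n) → ∣ p ∣ ≡ ∣ p ∩ q ∣ + ∣ p ─ q ∣
  ∣p∣≡∣p∩q∣+∣p─q∣ p q = trans
    (cong ∣_∣ (⊆-antisym (─∪-cover {p = p} {q = q}) (∪-lub ∩-prl (p─q⊆p p q))))
    (∣⊎∣ (p ∩ q) (p ─ q) λ x∈∩ x∈─ → x∈p─q⇒x∉q p q x∈─ (∩-prr x∈∩))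

  q⊆p⇒∣p∣≡∣q∣+∣p─q∣ : q ⊆ p → ∣ p ∣ ≡ ∣ q ∣ + ∣ p ─ q ∣
  q⊆p⇒∣p∣≡∣q∣+∣p─q∣ {q = q} {p = p} q⊆p = trans (∣p∣≡∣p∩q∣+∣p─q∣ p q)
    (cong (λ s → ∣ s ∣ + ∣ p ─ q ∣) (⊆-antisym ∩-prr (∩-glb q⊆p id)))

  ∣p∪⁅x⁆∣≤1+∣p∣ : ∀ (p : Subset n) x → ∣ p ∪ ⁅ x ⁆ ∣ ≤ suc ∣ p ∣
  ∣p∪⁅x⁆∣≤1+∣p∣ p x = ≤-trans (∣p∪q∣≤∣p∣+∣q∣ p ⁅ x ⁆)
    (≤-reflexive (trans (cong (∣ p ∣ +_) (∣⁅x⁆∣≡1 x)) (+-comm ∣ p ∣ 1)))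

  x∉p⇒∣p∪⁅x⁆∣≡1+∣p∣ : x ∉ p → ∣ p ∪ ⁅ x ⁆ ∣ ≡ suc ∣ p ∣
  x∉p⇒∣p∪⁅x⁆∣≡1+∣p∣ {x = x} {p = p} x∉p = trans
    (∣⊎∣ p ⁅ x ⁆ λ z∈p z∈x → x∉p (subst (_∈ p) (x∈⁅y⁆⇒x≡y x z∈x) z∈p))
    (trans (cong (∣ p ∣ +_) (∣⁅x⁆∣≡1 x)) (+-comm ∣ p ∣ 1))

  p-x∪⁅x⁆≡p : x ∈ p → (p - x) ∪ ⁅ x ⁆ ≡ p
  p-x∪⁅x⁆≡p {x = x} {p = p} x∈p = ⊆-antisym (∪-lub p-x⊆p (⁅⁆⊆ x∈p)) (p⊆p-x∪⁅x⁆ {x = x})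

  x∈p⇒∣p∣≡1+∣p-x∣ : x ∈ p → ∣ p ∣ ≡ suc ∣ p - x ∣
  x∈p⇒∣p∣≡1+∣p-x∣ {x = x} {p = p} x∈p = trans (cong ∣_∣ (sym (p-x∪⁅x⁆≡p x∈p)))
    (x∉p⇒∣p∪⁅x⁆∣≡1+∣p∣ λ z → x∈p-y⇒x≢y {p = p} z refl)

  ⊆∧∣∣≥⇒≡ : p ⊆ q → ∣ q ∣ ≤ ∣ p ∣ → p ≡ q
  ⊆∧∣∣≥⇒≡ {p = p} {q = q} p⊆q ∣q∣≤∣p∣ with q ⊆? p
  ... | yes q⊆p = ⊆-antisym p⊆q q⊆p
  ... | no  q⊈p = contradiction (p⊂q⇒∣p∣<∣q∣ (p⊆q , ⊈⇒∃ q⊈p)) (≤⇒≯ ∣q∣≤∣p∣)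

  subset-induction : ∀ {ℓ} (Q : Subset n → Set ℓ) → Q ⊥ →
    (∀ {s x} → x ∉ s → Q s → Q (s ∪ ⁅ x ⁆)) → ∀ s → Q s
  subset-induction Q q⊥ step s = go ∣ s ∣ s refl
    where
    go : ∀ k s → ∣ s ∣ ≡ k → Q s
    go k s ∣s∣≡k with nonempty? s
    ... | no  empty = subst Q (sym (Empty-unique empty)) q⊥
    go zero s ∣s∣≡0 | yes (x , x∈s) =
      contradiction (trans (sym ∣s∣≡0) (x∈p⇒∣p∣≡1+∣p-x∣ x∈s)) λ ()
    go (suc k) s ∣s∣≡ | yes (x , x∈s) = subst Q (p-x∪⁅x⁆≡p x∈s)
      (step (λ z → x∈p-y⇒x≢y {p = s} z refl)
        (go k (s - x) (suc-injective (trans (sym (x∈p⇒∣p∣≡1+∣p-x∣ x∈s)) ∣s∣≡))))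

-- Rank functions, closure, cyclic part, duality and contraction

-- Rank functions, unlike families of independent sets, have closed formulas for the dual and for
-- contractions. `submod` has monotonicity built in: `U` and `V` need only lie inside the union and
-- the intersection, which avoids rewriting sets.
record RankFunction (n : ℕ) : Set where
  field
    r      : Subset n → ℕ
    mono   : ∀ {X Y} → X ⊆ Y → r X ≤ r Y
    card   : ∀ X → r X ≤ ∣ X ∣
    submod : ∀ {U V} A B → U ⊆ A ∪ B → V ⊆ A → V ⊆ B → r U + r V ≤ r A + r B

  r-∪ : ∀ A B → r (A ∪ B) ≤ r A + ∣ B ∣
  r-∪ A B = begin
    r (A ∪ B)         ≤⟨ m≤m+n _ _ ⟩
    r (A ∪ B) + r ⊥   ≤⟨ submod A B id (⊥-elim ∘ ∉⊥) (⊥-elim ∘ ∉⊥) ⟩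
    r A + r B         ≤⟨ +-monoʳ-≤ (r A) (card B) ⟩
    r A + ∣ B ∣       ∎
    where open ≤-Reasoning

  r-⊆∪ : ∀ {U} A B → U ⊆ A ∪ B → r U ≤ r A + ∣ B ∣
  r-⊆∪ A B U⊆ = ≤-trans (mono U⊆) (r-∪ A B)

  in-cl? : ∀ Y e → Dec (r (Y ∪ ⁅ e ⁆) ≤ r Y)
  in-cl? Y e = r (Y ∪ ⁅ e ⁆) ≤? r Y

  cl : Subset n → Subset n
  cl Y = setOf (in-cl? Y)

  ∈cl⁺ : ∀ {Y e} → r (Y ∪ ⁅ e ⁆) ≤ r Y → e ∈ cl Y
  ∈cl⁺ {Y} = ∈-setOf⁺ (in-cl? Y)

  ∈cl⁻ : ∀ {Y e} → e ∈ cl Y → r (Y ∪ ⁅ e ⁆) ≤ r Y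
  ∈cl⁻ {Y} = ∈-setOf⁻ (in-cl? Y)

  in-cyc? : ∀ Y e → Dec (e ∈ Y × r Y ≤ r (Y - e))
  in-cyc? Y e = (e ∈? Y) ×-dec (r Y ≤? r (Y - e))

  -- The non-isthmuses of the restriction to `Y`. For a matroid this is the union of the circuits
  -- inside `Y` (`∈cyc⇔∈circuit`), so that `cyc (A ∩ B)` is the meet of two cyclic flats.
  cyc : Subset n → Subset n
  cyc Y = setOf (in-cyc? Y)

  ∈cyc⁺ : ∀ {Y e} → e ∈ Y → r Y ≤ r (Y - e) → e ∈ cyc Y
  ∈cyc⁺ {Y} e∈Y r≤ = ∈-setOf⁺ (in-cyc? Y) (e∈Y , r≤)

  ∈cyc⁻ : ∀ {Y e} → e ∈ cyc Y → e ∈ Y × r Y ≤ r (Y - e)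
  ∈cyc⁻ {Y} = ∈-setOf⁻ (in-cyc? Y)

  ⊆cl : ∀ {Y} → Y ⊆ cl Y
  ⊆cl e∈Y = ∈cl⁺ (mono (∪-lub id (⁅⁆⊆ e∈Y)))

  -- Diminishing returns: by submodularity `e` gains no more rank over `Y′` than over the smaller
  -- set `Y`.
  cl-mono : ∀ {Y Y′} → Y ⊆ Y′ → cl Y ⊆ cl Y′
  cl-mono {Y} {Y′} Y⊆Y′ {e} e∈ = ∈cl⁺ (+-cancelʳ-≤ (r Y) _ _ (begin
    r (Y′ ∪ ⁅ e ⁆) + r Y  ≤⟨ submod Y′ (Y ∪ ⁅ e ⁆) (∪-mono id ∪-inr) Y⊆Y′ ∪-inl ⟩
    r Y′ + r (Y ∪ ⁅ e ⁆)  ≤⟨ +-monoʳ-≤ (r Y′) (∈cl⁻ e∈) ⟩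
    r Y′ + r Y            ∎))
    where open ≤-Reasoning

  r-∪-closure : ∀ Y S → S ⊆ cl Y → r (Y ∪ S) ≤ r Y
  r-∪-closure Y = subset-induction (λ S → S ⊆ cl Y → r (Y ∪ S) ≤ r Y)
    (λ _ → mono (∪-lub id (⊥-elim ∘ ∉⊥)))
    λ {S} {x} _ ih S∪x⊆ → +-cancelʳ-≤ (r Y) _ _ (begin
      r (Y ∪ (S ∪ ⁅ x ⁆)) + r Y      ≤⟨ submod (Y ∪ S) (Y ∪ ⁅ x ⁆)
                                          (∪-lub (∪-inl ∘ ∪-inl) (∪-mono ∪-inr ∪-inr)) ∪-inl ∪-inl ⟩
      r (Y ∪ S) + r (Y ∪ ⁅ x ⁆)      ≤⟨ +-mono-≤ (ih (S∪x⊆ ∘ ∪-inl)) (∈cl⁻ (S∪x⊆ (∪-inr (x∈⁅x⁆ x)))) ⟩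
      r Y + r Y                      ∎)
    where open ≤-Reasoning

  r-⊆cl : ∀ {Y S} → S ⊆ cl Y → r S ≤ r Y
  r-⊆cl {Y} {S} S⊆ = ≤-trans (mono ∪-inr) (r-∪-closure Y S S⊆)

  IsFlat : Subset n → Set
  IsFlat Y = cl Y ⊆ Y

  IsCyclic : Subset n → Set
  IsCyclic Y = Y ⊆ cyc Y

  IsCyclicFlat : Subset n → Set
  IsCyclicFlat Y = IsFlat Y × IsCyclic Y

  cyclicFlat? : ∀ Y → Dec (IsCyclicFlat Y)
  cyclicFlat? Y = (cl Y ⊆? Y) ×-dec (Y ⊆? cyc Y)

  cl-flat : ∀ {Y} → IsFlat (cl Y)
  cl-flat {Y} {e} e∈ = ∈cl⁺ (begin
    r (Y ∪ ⁅ e ⁆)     ≤⟨ mono (∪-mono ⊆cl id) ⟩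
    r (cl Y ∪ ⁅ e ⁆)  ≤⟨ ∈cl⁻ e∈ ⟩
    r (cl Y)          ≤⟨ r-⊆cl id ⟩
    r Y               ∎)
    where open ≤-Reasoning

  cl-least : ∀ {Y F} → Y ⊆ F → IsFlat F → cl Y ⊆ F
  cl-least Y⊆F flat e∈ = flat (cl-mono Y⊆F e∈)

  ∩-flat : ∀ {A B} → IsFlat A → IsFlat B → IsFlat (A ∩ B)
  ∩-flat flatA flatB = ∩-glb (cl-least ∩-prl flatA) (cl-least ∩-prr flatB)

  cyc⊆ : ∀ {Y} → cyc Y ⊆ Y
  cyc⊆ = proj₁ ∘ ∈cyc⁻

  cyc-mono : ∀ {Y Y′} → Y ⊆ Y′ → cyc Y ⊆ cyc Y′
  cyc-mono {Y} {Y′} Y⊆Y′ {e} e∈ = ∈cyc⁺ (Y⊆Y′ (cyc⊆ e∈)) (+-cancelʳ-≤ (r (Y - e)) _ _ (begin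
    r Y′ + r (Y - e)        ≤⟨ submod (Y′ - e) Y cover (-‿mono Y⊆Y′) p-x⊆p ⟩
    r (Y′ - e) + r Y        ≤⟨ +-monoʳ-≤ (r (Y′ - e)) (proj₂ (∈cyc⁻ e∈)) ⟩
    r (Y′ - e) + r (Y - e)  ∎))
    where
    open ≤-Reasoning
    cover : Y′ ⊆ (Y′ - e) ∪ Y
    cover = ∪-mono id (⁅⁆⊆ (cyc⊆ e∈)) ∘ p⊆p-x∪⁅x⁆ {x = e}

  -- An element added by the closure is no isthmus, because `Y` avoids it and already has the full
  -- rank.
  cl-cyclic : ∀ {Y} → IsCyclic Y → IsCyclic (cl Y)
  cl-cyclic {Y} cyclic {e} e∈ with e ∈? Y
  ... | yes e∈Y = cyc-mono ⊆cl (cyclic e∈Y)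
  ... | no  e∉Y = ∈cyc⁺ e∈ (≤-trans (r-⊆cl id) (mono (⊆- ⊆cl e∉Y)))

  ∪-cyclic : ∀ {A B} → IsCyclic A → IsCyclic B → IsCyclic (A ∪ B)
  ∪-cyclic cyclicA cyclicB = ∪-lub (cyc-mono ∪-inl ∘ cyclicA) (cyc-mono ∪-inr ∘ cyclicB)

  -- By submodularity an isthmus `x` of `Y ∪ T` raises the rank of every subset of `(Y ∪ T) - x`
  -- when it is added. So each element of `T`, added to `Y` in turn, contributes one.
  isthmuses-additive : ∀ Y T → (∀ {e} → e ∈ T → e ∉ Y) →
    (∀ {e} → e ∈ T → r ((Y ∪ T) - e) < r (Y ∪ T)) → r Y + ∣ T ∣ ≤ r (Y ∪ T)
  isthmuses-additive Y T T∉Y isthmus = subset-induction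
    (λ S → S ⊆ T → r Y + ∣ S ∣ ≤ r (Y ∪ S))
    (λ _ → ≤-trans (≤-reflexive (trans (cong (r Y +_) (∣⊥∣≡0 n)) (+-identityʳ (r Y)))) (mono ∪-inl))
    step T id
    where
    open ≤-Reasoning
    step : ∀ {S x} → x ∉ S → (S ⊆ T → r Y + ∣ S ∣ ≤ r (Y ∪ S)) →
           S ∪ ⁅ x ⁆ ⊆ T → r Y + ∣ S ∪ ⁅ x ⁆ ∣ ≤ r (Y ∪ (S ∪ ⁅ x ⁆))
    step {S} {x} x∉S ih S∪x⊆T = +-cancelʳ-≤ (r ((Y ∪ T) - x)) _ _ (begin
      r Y + ∣ S ∪ ⁅ x ⁆ ∣ + r ((Y ∪ T) - x)      ≤⟨ +-monoˡ-≤ _ (+-monoʳ-≤ (r Y) (∣p∪⁅x⁆∣≤1+∣p∣ S x)) ⟩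
      r Y + suc ∣ S ∣ + r ((Y ∪ T) - x)          ≡⟨ shift (r Y) ∣ S ∣ _ ⟩
      suc (r ((Y ∪ T) - x)) + (r Y + ∣ S ∣)      ≤⟨ +-mono-≤ (isthmus x∈T) (ih (S∪x⊆T ∘ ∪-inl)) ⟩
      r (Y ∪ T) + r (Y ∪ S)                      ≤⟨ submod _ _ cover (∪-mono id ∪-inl)
                                                      (⊆- (∪-mono id (S∪x⊆T ∘ ∪-inl)) x∉Y∪S) ⟩
      r (Y ∪ (S ∪ ⁅ x ⁆)) + r ((Y ∪ T) - x)      ∎)
      where
      x∈T : x ∈ T
      x∈T = S∪x⊆T (∪-inr (x∈⁅x⁆ x))
      x∉Y∪S : x ∉ Y ∪ S
      x∉Y∪S = [ T∉Y x∈T , x∉S ]′ ∘ ∪-split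
      cover : Y ∪ T ⊆ (Y ∪ (S ∪ ⁅ x ⁆)) ∪ ((Y ∪ T) - x)
      cover = ∪-lub ∪-inr (∪-inl ∘ ∪-inr ∘ ∪-inr) ∘ p⊆p-x∪⁅x⁆ {x = x}
      shift : ∀ a b c → a + suc b + c ≡ suc c + (a + b)
      shift = solve-∀

  r-cyc : ∀ Y → r (cyc Y) + ∣ Y ─ cyc Y ∣ ≤ r Y
  r-cyc Y = ≤-trans
    (isthmuses-additive (cyc Y) (Y ─ cyc Y) (x∈p─q⇒x∉q Y (cyc Y))
      λ {e} e∈ → ≰⇒> λ le → x∈p─q⇒x∉q Y (cyc Y) e∈ (∈cyc⁺ (p─q⊆p Y (cyc Y) e∈)
        (≤-trans (mono Y⊆) (≤-trans le (mono (-‿mono ⊆Y))))))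
    (mono ⊆Y)
    where
    ⊆Y : cyc Y ∪ (Y ─ cyc Y) ⊆ Y
    ⊆Y = ∪-lub cyc⊆ (p─q⊆p Y (cyc Y))
    Y⊆ : Y ⊆ cyc Y ∪ (Y ─ cyc Y)
    Y⊆ = ∪-mono ∩-prr id ∘ ─∪-cover {p = Y}

  -- By `r-cyc` the isthmuses of `Y` contribute their full number to its rank. If removing `e` costs
  -- `Y` no rank, the loss cannot be hidden in the isthmuses, and `cyc Y` loses none either.
  cyc-cyclic : ∀ {Y} → IsCyclic (cyc Y)
  cyc-cyclic {Y} {e} e∈ = ∈cyc⁺ e∈ (+-cancelʳ-≤ (∣ Y ─ cyc Y ∣) _ _ (begin
    r (cyc Y) + ∣ Y ─ cyc Y ∣      ≤⟨ r-cyc Y ⟩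
    r Y                            ≤⟨ proj₂ (∈cyc⁻ e∈) ⟩
    r (Y - e)                      ≤⟨ r-⊆∪ (cyc Y - e) (Y ─ cyc Y) cover ⟩
    r (cyc Y - e) + ∣ Y ─ cyc Y ∣  ∎))
    where
    open ≤-Reasoning
    cover : Y - e ⊆ (cyc Y - e) ∪ (Y ─ cyc Y)
    cover z with ∪-split (─∪-cover {q = cyc Y} (p-x⊆p z))
    ... | inj₁ z∈ = ∪-inl (x∈p∧x≢y⇒x∈p-y (∩-prr z∈) (x∈p-y⇒x≢y {p = Y} z))
    ... | inj₂ z∈ = ∪-inr z∈

  -- An element `e` in the closure of `cyc Y` but outside `cyc Y` would be spanned by a subset of
  -- `Y - e`. It would then be no isthmus of `Y`, hence an element of `cyc Y` after all.
  cyc-flat : ∀ {Y} → IsFlat Y → IsFlat (cyc Y)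
  cyc-flat {Y} flat {e} e∈ with e ∈? cyc Y
  ... | yes e∈cyc = e∈cyc
  ... | no  e∉cyc = ∈cyc⁺ e∈Y (+-cancelʳ-≤ (r (cyc Y)) _ _ (begin
    r Y + r (cyc Y)                ≤⟨ submod (Y - e) (cyc Y ∪ ⁅ e ⁆)
                                        (∪-mono id ∪-inr ∘ p⊆p-x∪⁅x⁆ {x = e}) (⊆- cyc⊆ e∉cyc) ∪-inl ⟩
    r (Y - e) + r (cyc Y ∪ ⁅ e ⁆)  ≤⟨ +-monoʳ-≤ (r (Y - e)) (∈cl⁻ e∈) ⟩
    r (Y - e) + r (cyc Y)          ∎))
    where
    open ≤-Reasoning
    e∈Y : e ∈ Y
    e∈Y = cl-least cyc⊆ flat e∈

  cyc-cyclicFlat : ∀ {Y} → IsFlat Y → IsCyclicFlat (cyc Y)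
  cyc-cyclicFlat flat = cyc-flat flat , cyc-cyclic

  cl-cyclicFlat : ∀ {Y} → IsCyclic Y → IsCyclicFlat (cl Y)
  cl-cyclicFlat cyclic = cl-flat , cl-cyclic cyclic

module _ {n : ℕ} (R : RankFunction n) where
  open RankFunction R

  private
    dual-r : Subset n → ℕ
    dual-r Y = ∣ Y ∣ + r (∁ Y) ∸ r ⊤

    dual-r-≡ : ∀ Y → dual-r Y + r ⊤ ≡ ∣ Y ∣ + r (∁ Y)
    dual-r-≡ Y = m∸n+n≡m (begin
      r ⊤                ≤⟨ r-⊆∪ (∁ Y) Y (λ {x} _ → [ ∪-inr , ∪-inl ]′ (∈-or-∈∁ x Y)) ⟩
      r (∁ Y) + ∣ Y ∣    ≡⟨ +-comm (r (∁ Y)) _ ⟩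
      ∣ Y ∣ + r (∁ Y)    ∎)
      where open ≤-Reasoning

    dual-r-mono : ∀ {X Y} → X ⊆ Y → dual-r X ≤ dual-r Y
    dual-r-mono {X} {Y} X⊆Y = ∸-monoˡ-≤ (r ⊤) (begin
      ∣ X ∣ + r (∁ X)                    ≤⟨ +-monoʳ-≤ ∣ X ∣ (r-⊆∪ (∁ Y) (Y ─ X) cover) ⟩
      ∣ X ∣ + (r (∁ Y) + ∣ Y ─ X ∣)      ≡⟨ shift ∣ X ∣ _ _ ⟩
      ∣ X ∣ + ∣ Y ─ X ∣ + r (∁ Y)        ≡⟨ cong (_+ r (∁ Y)) (q⊆p⇒∣p∣≡∣q∣+∣p─q∣ X⊆Y) ⟨
      ∣ Y ∣ + r (∁ Y)                    ∎)
      where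
      open ≤-Reasoning
      shift : ∀ a b c → a + (b + c) ≡ a + c + b
      shift = solve-∀
      cover : ∁ X ⊆ ∁ Y ∪ (Y ─ X)
      cover {x} z with ∈-or-∈∁ x Y
      ... | inj₁ x∈Y  = ∪-inr (x∈p∧x∉q⇒x∈p─q x∈Y (x∈∁p⇒x∉p z))
      ... | inj₂ x∈∁Y = ∪-inl x∈∁Y

    dual-r-submod : ∀ {U V} A B → U ⊆ A ∪ B → V ⊆ A → V ⊆ B →
                    dual-r U + dual-r V ≤ dual-r A + dual-r B
    dual-r-submod {U} {V} A B U⊆ V⊆A V⊆B = ≤-trans
      (+-mono-≤ (dual-r-mono U⊆) (dual-r-mono (∩-glb V⊆A V⊆B)))
      (+-cancelʳ-≤ (r ⊤ + r ⊤) _ _ (begin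
        dual-r (A ∪ B) + dual-r (A ∩ B) + (r ⊤ + r ⊤)               ≡⟨ merge (dual-r (A ∪ B)) (dual-r (A ∩ B)) (r ⊤) ⟩
        (dual-r (A ∪ B) + r ⊤) + (dual-r (A ∩ B) + r ⊤)             ≡⟨ cong₂ _+_ (dual-r-≡ (A ∪ B)) (dual-r-≡ (A ∩ B)) ⟩
        (∣ A ∪ B ∣ + r (∁ (A ∪ B))) + (∣ A ∩ B ∣ + r (∁ (A ∩ B)))   ≡⟨ interchange ∣ A ∪ B ∣ _ _ _ ⟩
        (∣ A ∪ B ∣ + ∣ A ∩ B ∣) + (r (∁ (A ∩ B)) + r (∁ (A ∪ B)))   ≤⟨ +-mono-≤ (≤-reflexive (∣p∪q∣+∣p∩q∣≡∣p∣+∣q∣ A B))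
                                                                         (submod (∁ A) (∁ B) cover (∁-anti ∪-inl) (∁-anti ∪-inr)) ⟩
        (∣ A ∣ + ∣ B ∣) + (r (∁ A) + r (∁ B))                       ≡⟨ interchange′ ∣ A ∣ _ _ _ ⟩
        (∣ A ∣ + r (∁ A)) + (∣ B ∣ + r (∁ B))                       ≡⟨ cong₂ _+_ (dual-r-≡ A) (dual-r-≡ B) ⟨
        (dual-r A + r ⊤) + (dual-r B + r ⊤)                         ≡⟨ merge (dual-r A) (dual-r B) (r ⊤) ⟨
        dual-r A + dual-r B + (r ⊤ + r ⊤)                           ∎))
      where
      open ≤-Reasoning
      merge : ∀ a b c → a + b + (c + c) ≡ (a + c) + (b + c)
      merge = solve-∀
      interchange : ∀ a b c d → (a + b) + (c + d) ≡ (a + c) + (d + b)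
      interchange = solve-∀
      interchange′ : ∀ a b c d → (a + b) + (c + d) ≡ (a + c) + (b + d)
      interchange′ = solve-∀
      cover : ∁ (A ∩ B) ⊆ ∁ A ∪ ∁ B
      cover {x} z with ∈-or-∈∁ x A | ∈-or-∈∁ x B
      ... | inj₁ x∈A | inj₁ x∈B = ⊥-elim (x∈∁p⇒x∉p z (x∈p∩q⁺ (x∈A , x∈B)))
      ... | inj₂ x∉A | _        = ∪-inl x∉A
      ... | _        | inj₂ x∉B = ∪-inr x∉B

  dualRank : RankFunction n
  dualRank = record
    { r      = dual-r
    ; mono   = dual-r-mono
    ; card   = λ Y → +-cancelʳ-≤ (r ⊤) _ _
                 (≤-trans (≤-reflexive (dual-r-≡ Y)) (+-monoʳ-≤ ∣ Y ∣ (mono ⊆⊤)))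
    ; submod = dual-r-submod
    }

  dualRank-≡ : ∀ Y → RankFunction.r dualRank Y + r ⊤ ≡ ∣ Y ∣ + r (∁ Y)
  dualRank-≡ = dual-r-≡

  private
    module R* = RankFunction dualRank

  -- Moving an isthmus `e` of `∁ S` over to `S` raises the cardinality by one and lowers the rank of
  -- the complement by at least one, so the dual rank does not grow.
  ∉cyc-∁⇒∈dual-cl : ∀ {S e} → e ∉ cyc (∁ S) → e ∈ R*.cl S
  ∉cyc-∁⇒∈dual-cl {S} {e} e∉cyc with e ∈? S
  ... | yes e∈S = R*.⊆cl e∈S
  ... | no  e∉S = R*.∈cl⁺ (∸-monoˡ-≤ (r ⊤) (begin
    ∣ S ∪ ⁅ e ⁆ ∣ + r (∁ (S ∪ ⁅ e ⁆))  ≤⟨ +-mono-≤ (∣p∪⁅x⁆∣≤1+∣p∣ S e) (mono cover) ⟩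
    suc ∣ S ∣ + r (∁ S - e)            ≡⟨ +-suc _ _ ⟨
    ∣ S ∣ + suc (r (∁ S - e))          ≤⟨ +-monoʳ-≤ ∣ S ∣ (≰⇒> λ le → e∉cyc (∈cyc⁺ (x∉p⇒x∈∁p e∉S) le)) ⟩
    ∣ S ∣ + r (∁ S)                    ∎))
    where
    open ≤-Reasoning
    cover : ∁ (S ∪ ⁅ e ⁆) ⊆ ∁ S - e
    cover z = x∈p∧x≢y⇒x∈p-y (∁-anti ∪-inl z) λ { refl → x∈∁p⇒x∉p z (∪-inr (x∈⁅x⁆ e)) }

  -- Complementation exchanges the two conditions: an element of `Y` in the closure of `∁ Y` would
  -- be an isthmus of `Y` in the dual, and an isthmus of `∁ Y` would lie in the dual closure of `Y`.
  dual-cyclicFlat : ∀ {Y} → R*.IsCyclicFlat Y → IsCyclicFlat (∁ Y)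
  dual-cyclicFlat {Y} (flat* , cyclic*) = flat , cyclic
    where
    open ≤-Reasoning

    flat : IsFlat (∁ Y)
    flat {e} e∈ with ∈-or-∈∁ e Y
    ... | inj₂ e∈∁Y = e∈∁Y
    ... | inj₁ e∈Y  = ⊥-elim (<-irrefl refl (+-cancelˡ-≤ ∣ Y - e ∣ _ _ (begin
      ∣ Y - e ∣ + suc (r (∁ Y))     ≡⟨ +-suc _ _ ⟩
      suc ∣ Y - e ∣ + r (∁ Y)       ≡⟨ cong (_+ r (∁ Y)) (x∈p⇒∣p∣≡1+∣p-x∣ e∈Y) ⟨
      ∣ Y ∣ + r (∁ Y)               ≡⟨ dualRank-≡ Y ⟨
      R*.r Y + r ⊤                  ≤⟨ +-monoˡ-≤ (r ⊤) (proj₂ (R*.∈cyc⁻ (cyclic* e∈Y))) ⟩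
      R*.r (Y - e) + r ⊤            ≡⟨ dualRank-≡ (Y - e) ⟩
      ∣ Y - e ∣ + r (∁ (Y - e))     ≤⟨ +-monoʳ-≤ ∣ Y - e ∣ (≤-trans (mono cover) (∈cl⁻ e∈)) ⟩
      ∣ Y - e ∣ + r (∁ Y)           ∎)))
      where
      cover : ∁ (Y - e) ⊆ ∁ Y ∪ ⁅ e ⁆
      cover {x} z with x ≟ e
      ... | yes refl = ∪-inr (x∈⁅x⁆ x)
      ... | no  x≢e  = ∪-inl (x∉p⇒x∈∁p λ x∈Y → x∈∁p⇒x∉p z (x∈p∧x≢y⇒x∈p-y x∈Y x≢e))

    cyclic : IsCyclic (∁ Y)
    cyclic {e} e∈ with e ∈? cyc (∁ Y)
    ... | yes e∈cyc = e∈cyc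
    ... | no  e∉cyc = ⊥-elim (x∈∁p⇒x∉p e∈ (flat* (∉cyc-∁⇒∈dual-cl e∉cyc)))

  module _ (X : Subset n) where
    private
      contract-r : Subset n → ℕ
      contract-r Y = r (Y ∪ X) ∸ r X

      contract-r-≡ : ∀ Y → contract-r Y + r X ≡ r (Y ∪ X)
      contract-r-≡ Y = m∸n+n≡m (mono ∪-inr)

    -- The contraction stays on all of `Fin n`, with the elements of `X` turned into loops, so that
    -- no change of ground set is needed.
    contractRank : RankFunction n
    contractRank = record
      { r      = contract-r
      ; mono   = λ X⊆Y → ∸-monoˡ-≤ (r X) (mono (∪-mono X⊆Y id))
      ; card   = λ Y → +-cancelʳ-≤ (r X) _ _ (begin
          contract-r Y + r X  ≡⟨ contract-r-≡ Y ⟩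
          r (Y ∪ X)           ≤⟨ r-⊆∪ X Y ∪-swap ⟩
          r X + ∣ Y ∣         ≡⟨ +-comm (r X) _ ⟩
          ∣ Y ∣ + r X         ∎)
      ; submod = λ {U} {V} A B U⊆ V⊆A V⊆B → +-cancelʳ-≤ (r X + r X) _ _ (begin
          contract-r U + contract-r V + (r X + r X)      ≡⟨ merge (contract-r U) (contract-r V) (r X) ⟩
          (contract-r U + r X) + (contract-r V + r X)    ≡⟨ cong₂ _+_ (contract-r-≡ U) (contract-r-≡ V) ⟩
          r (U ∪ X) + r (V ∪ X)                          ≤⟨ submod (A ∪ X) (B ∪ X)
                                                              (∪-lub (∪-mono ∪-inl ∪-inl ∘ U⊆) (∪-inl ∘ ∪-inr))
                                                              (∪-mono V⊆A id) (∪-mono V⊆B id) ⟩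
          r (A ∪ X) + r (B ∪ X)                          ≡⟨ cong₂ _+_ (contract-r-≡ A) (contract-r-≡ B) ⟨
          (contract-r A + r X) + (contract-r B + r X)    ≡⟨ merge (contract-r A) (contract-r B) (r X) ⟨
          contract-r A + contract-r B + (r X + r X)      ∎)
      }
      where
      open ≤-Reasoning
      merge : ∀ a b c → a + b + (c + c) ≡ (a + c) + (b + c)
      merge = solve-∀

    contractRank-≡ : ∀ Y → RankFunction.r contractRank Y + r X ≡ r (Y ∪ X)
    contractRank-≡ = contract-r-≡

-- Matchings

∣p∣≥1⇒nonempty : ∀ {n} {p : Subset n} → 1 ≤ ∣ p ∣ → Nonempty p
∣p∣≥1⇒nonempty {n} {p} 1≤∣p∣ with nonempty? p
... | yes ne = ne
... | no  em = contradiction (≤-trans 1≤∣p∣ (≤-reflexive (trans (cong ∣_∣ (Empty-unique em)) (∣⊥∣≡0 n)))) λ ()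

injectiveOn⇒∣∣≤ : ∀ {n k} (φ : Fin n → Fin k) S T → (∀ x → x ∈ S → φ x ∈ T) →
  (∀ x y → x ∈ S → y ∈ S → φ x ≡ φ y → x ≡ y) → ∣ S ∣ ≤ ∣ T ∣
injectiveOn⇒∣∣≤ {n} φ = subset-induction
  (λ S → ∀ T → (∀ x → x ∈ S → φ x ∈ T) →
         (∀ x y → x ∈ S → y ∈ S → φ x ≡ φ y → x ≡ y) → ∣ S ∣ ≤ ∣ T ∣)
  (λ T _ _ → ≤-trans (≤-reflexive (∣⊥∣≡0 n)) z≤n)
  λ {s} {x} x∉s ih T into inj → begin
    ∣ s ∪ ⁅ x ⁆ ∣       ≡⟨ x∉p⇒∣p∪⁅x⁆∣≡1+∣p∣ x∉s ⟩
    suc ∣ s ∣           ≤⟨ s≤s (ih (T - φ x)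
                             (λ y y∈s → x∈p∧x≢y⇒x∈p-y (into y (∪-inl y∈s)) λ φy≡φx →
                               x∉s (subst (_∈ s) (inj y x (∪-inl y∈s) (∪-inr (x∈⁅x⁆ x)) φy≡φx) y∈s))
                             (λ y z y∈s z∈s → inj y z (∪-inl y∈s) (∪-inl z∈s))) ⟩
    suc ∣ T - φ x ∣     ≡⟨ x∈p⇒∣p∣≡1+∣p-x∣ (into x (∪-inr (x∈⁅x⁆ x))) ⟨
    ∣ T ∣               ∎
  where open ≤-Reasoning

-- Rado's argument: as long as a neighbourhood has two points, one of them can be dropped
-- without violating Hall's condition, because |Γ| is submodular.
module _ {n k : ℕ} where

  in-Γ? : (N : Fin n → Subset k) (Y : Subset n) (i : Fin k) → Dec (∃ λ y → y ∈ Y × i ∈ N y)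
  in-Γ? N Y i = any? λ y → (y ∈? Y) ×-dec (i ∈? N y)

  Γ : (Fin n → Subset k) → Subset n → Subset k
  Γ N Y = setOf (in-Γ? N Y)

  ∈Γ⁺ : ∀ {N Y y i} → y ∈ Y → i ∈ N y → i ∈ Γ N Y
  ∈Γ⁺ {N} {Y} y∈Y i∈Ny = ∈-setOf⁺ (in-Γ? N Y) (_ , y∈Y , i∈Ny)

  ∈Γ⁻ : ∀ {N Y i} → i ∈ Γ N Y → ∃ λ y → y ∈ Y × i ∈ N y
  ∈Γ⁻ {N} {Y} = ∈-setOf⁻ (in-Γ? N Y)

  HallCondition : (Fin n → Subset k) → Subset n → Set
  HallCondition N I = ∀ Y → Y ⊆ I → ∣ Y ∣ ≤ ∣ Γ N Y ∣

  hall-or-violated : ∀ N I → HallCondition N I ⊎ ∃ λ Y → Y ⊆ I × ∣ Γ N Y ∣ < ∣ Y ∣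
  hall-or-violated N I with anySubset? (λ Y → (Y ⊆? I) ×-dec (∣ Γ N Y ∣ <? ∣ Y ∣))
  ... | yes violated = inj₂ violated
  ... | no  fine     = inj₁ λ Y Y⊆I → ≮⇒≥ λ lt → fine (Y , Y⊆I , lt)

  drop : (Fin n → Subset k) → Fin n → Fin k → Fin n → Subset k
  drop N x i y with y ≟ x
  ... | yes _ = N y - i
  ... | no  _ = N y

  drop-⊆ : ∀ N x i y → drop N x i y ⊆ N y
  drop-⊆ N x i y with y ≟ x
  ... | yes _ = p-x⊆p
  ... | no  _ = id

  drop-same : ∀ N x i → drop N x i x ≡ N x - i
  drop-same N x i with x ≟ x
  ... | yes _   = refl
  ... | no  x≢x = contradiction refl x≢x

  ∈drop : ∀ {N x i y l} → l ∈ N y → (y ≡ x → l ≢ i) → l ∈ drop N x i y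
  ∈drop {x = x} {y = y} l∈ l≢i with y ≟ x
  ... | yes y≡x = x∈p∧x≢y⇒x∈p-y l∈ (l≢i y≡x)
  ... | no  _   = l∈

  module _ {N : Fin n → Subset k} {I : Subset n} (hall : HallCondition N I) where

    violator-∋ : ∀ {x i Y} → Y ⊆ I → ∣ Γ (drop N x i) Y ∣ < ∣ Y ∣ → x ∈ Y
    violator-∋ {x} {i} {Y} Y⊆I lt with x ∈? Y
    ... | yes x∈Y = x∈Y
    ... | no  x∉Y = contradiction (≤-trans (hall Y Y⊆I) (p⊆q⇒∣p∣≤∣q∣ incl)) (<⇒≱ lt)
      where
      incl : Γ N Y ⊆ Γ (drop N x i) Y
      incl l∈ with ∈Γ⁻ {N} l∈
      ... | y , y∈Y , l∈Ny = ∈Γ⁺ y∈Y (∈drop {N} l∈Ny λ { refl → contradiction y∈Y x∉Y })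

    -- Suppose `Y` violates the condition after dropping `i`, and `Z` after dropping `j`. Both
    -- contain `x`. As `i ≢ j`, every neighbour of `Y ∪ Z` survives in `P` or in `Q`, and the
    -- neighbours of `Y ∩ Z - x` survive in both. Hall's condition for `N` on these two sets, whose
    -- sizes add up to one less than those of `Y` and `Z`, contradicts the two violations.
    droppable : ∀ {x i j} → i ≢ j →
      HallCondition (drop N x i) I ⊎ HallCondition (drop N x j) I
    droppable {x} {i} {j} i≢j with hall-or-violated (drop N x i) I | hall-or-violated (drop N x j) I
    ... | inj₁ h | _      = inj₁ h
    ... | inj₂ _ | inj₁ h = inj₂ h
    ... | inj₂ (Y , Y⊆I , vY) | inj₂ (Z , Z⊆I , vZ) = ⊥-elim (<-irrefl refl (begin-strict
      ∣ Y ∣ + ∣ Z ∣                               ≡⟨ ∣p∪q∣+∣p∩q∣≡∣p∣+∣q∣ Y Z ⟨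
      ∣ Y ∪ Z ∣ + ∣ Y ∩ Z ∣                       ≡⟨ cong (∣ Y ∪ Z ∣ +_) (x∈p⇒∣p∣≡1+∣p-x∣ (x∈p∩q⁺ (x∈Y , x∈Z))) ⟩
      ∣ Y ∪ Z ∣ + suc ∣ Y ∩ Z - x ∣               ≡⟨ +-suc _ _ ⟩
      suc (∣ Y ∪ Z ∣ + ∣ Y ∩ Z - x ∣)             ≤⟨ s≤s (+-mono-≤ (hall (Y ∪ Z) (∪-lub Y⊆I Z⊆I))
                                                                (hall (Y ∩ Z - x) (Y⊆I ∘ ∩-prl ∘ p-x⊆p))) ⟩
      suc (∣ Γ N (Y ∪ Z) ∣ + ∣ Γ N (Y ∩ Z - x) ∣) ≤⟨ s≤s (+-mono-≤ (p⊆q⇒∣p∣≤∣q∣ ⊆∪) (p⊆q⇒∣p∣≤∣q∣ ⊆∩)) ⟩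
      suc (∣ P ∪ Q ∣ + ∣ P ∩ Q ∣)                 ≡⟨ cong suc (∣p∪q∣+∣p∩q∣≡∣p∣+∣q∣ P Q) ⟩
      suc (∣ P ∣ + ∣ Q ∣)                         <⟨ s≤s (≤-reflexive (sym (+-suc _ _))) ⟩
      suc ∣ P ∣ + suc ∣ Q ∣                       ≤⟨ +-mono-≤ vY vZ ⟩
      ∣ Y ∣ + ∣ Z ∣                               ∎))
      where
      open ≤-Reasoning
      P Q : Subset k
      P = Γ (drop N x i) Y
      Q = Γ (drop N x j) Z
      x∈Y : x ∈ Y
      x∈Y = violator-∋ Y⊆I vY
      x∈Z : x ∈ Z
      x∈Z = violator-∋ Z⊆I vZ
      ⊆∪ : Γ N (Y ∪ Z) ⊆ P ∪ Q
      ⊆∪ {l} l∈ with ∈Γ⁻ {N} l∈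
      ... | y , y∈ , l∈Ny with y ≟ x
      ... | no y≢x = [ (λ y∈Y → ∪-inl (∈Γ⁺ y∈Y (∈drop {N} l∈Ny (⊥-elim ∘ y≢x))))
                     , (λ y∈Z → ∪-inr (∈Γ⁺ y∈Z (∈drop {N} l∈Ny (⊥-elim ∘ y≢x)))) ]′ (∪-split y∈)
      ... | yes refl with l ≟ i
      ...   | no  l≢i  = ∪-inl (∈Γ⁺ x∈Y (∈drop {N} l∈Ny λ _ → l≢i))
      ...   | yes refl = ∪-inr (∈Γ⁺ x∈Z (∈drop {N} l∈Ny λ _ → i≢j))
      ⊆∩ : Γ N (Y ∩ Z - x) ⊆ P ∩ Q
      ⊆∩ {l} l∈ with ∈Γ⁻ {N} l∈
      ... | y , y∈ , l∈Ny = x∈p∩q⁺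
        ( ∈Γ⁺ (∩-prl (p-x⊆p y∈)) (∈drop {N} l∈Ny λ y≡x → contradiction y≡x (x∈p-y⇒x≢y {p = Y ∩ Z} y∈))
        , ∈Γ⁺ (∩-prr (p-x⊆p y∈)) (∈drop {N} l∈Ny λ y≡x → contradiction y≡x (x∈p-y⇒x≢y {p = Y ∩ Z} y∈)) )

  Refines : (N N′ : Fin n → Subset k) → Set
  Refines N N′ = ∀ y → N′ y ⊆ N y

  shrink-at : ∀ N I x → HallCondition N I →
    ∃ λ N′ → HallCondition N′ I × Refines N N′ × ∣ N′ x ∣ ≤ 1
  shrink-at N I x hall = go ∣ N x ∣ N hall ≤-refl
    where
    go : ∀ m N → HallCondition N I → ∣ N x ∣ ≤ m →
         ∃ λ N′ → HallCondition N′ I × Refines N N′ × ∣ N′ x ∣ ≤ 1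
    go m N hall bound with ∣ N x ∣ ≤? 1
    ... | yes ≤1 = N , hall , (λ _ → id) , ≤1
    go zero N hall bound | no ≰1 = contradiction (≤-trans bound z≤n) ≰1
    go (suc m) N hall bound | no ≰1 with ∣p∣≥1⇒nonempty (≤-trans (n≤1+n 1) (≰⇒> ≰1))
    ... | i , i∈ with ∣p∣≥1⇒nonempty {p = N x - i}
                        (≤-pred (≤-trans (≰⇒> ≰1) (≤-reflexive (x∈p⇒∣p∣≡1+∣p-x∣ i∈))))
    ... | j , j∈ = [ next i∈ , next (p-x⊆p j∈) ]′ (droppable hall (x∈p-y⇒x≢y {p = N x} j∈ ∘ sym))
      where
      next : ∀ {l} → l ∈ N x → HallCondition (drop N x l) I →
             ∃ λ N′ → HallCondition N′ I × Refines N N′ × ∣ N′ x ∣ ≤ 1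
      next {l} l∈ hall′ with go m (drop N x l) hall′ (≤-pred (begin
          suc ∣ drop N x l x ∣  ≡⟨ cong (suc ∘ ∣_∣) (drop-same N x l) ⟩
          suc ∣ N x - l ∣       ≡⟨ x∈p⇒∣p∣≡1+∣p-x∣ l∈ ⟨
          ∣ N x ∣               ≤⟨ bound ⟩
          suc m                 ∎))
        where open ≤-Reasoning
      ... | N′ , hall″ , ref , ≤1 = N′ , hall″ , (λ y → drop-⊆ N x l y ∘ ref y) , ≤1

  shrink : ∀ N I (xs : List (Fin n)) → HallCondition N I →
    ∃ λ N′ → HallCondition N′ I × Refines N N′ × (∀ {x} → x List.∈ xs → ∣ N′ x ∣ ≤ 1)
  shrink N I []       hall = N , hall , (λ _ → id) , λ ()
  shrink N I (x ∷ xs) hall with shrink N I xs hall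
  ... | N₁ , hall₁ , ref₁ , ≤1₁ with shrink-at N₁ I x hall₁
  ... | N₂ , hall₂ , ref₂ , ≤1₂ = N₂ , hall₂ , (λ y → ref₁ y ∘ ref₂ y) , λ
    { (here refl) → ≤1₂
    ; (there y∈)  → ≤-trans (p⊆q⇒∣p∣≤∣q∣ (ref₂ _)) (≤1₁ y∈) }

  -- Once every neighbourhood has at most one point, Hall's condition for singletons supplies that
  -- point and for pairs makes the choice injective. `default` is the value of `φ` outside `I`.
  marriage : Fin k → ∀ N I → HallCondition N I → Σ (Fin n → Fin k) λ φ →
    (∀ e → e ∈ I → φ e ∈ N e) × (∀ e e′ → e ∈ I → e′ ∈ I → φ e ≡ φ e′ → e ≡ e′)
  marriage default N I hall with shrink N I (allFin n) hall
  ... | N′ , hall′ , ref , ≤1 = φ , (λ e → ref e ∘ φ∈ e) , injective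
    where
    choose : ∀ e → ∃ λ i → e ∈ I → i ∈ N′ e
    choose e with e ∈? I
    ... | no  e∉I = default , λ e∈I → contradiction e∈I e∉I
    ... | yes e∈I with ∣p∣≥1⇒nonempty {p = Γ N′ ⁅ e ⁆}
                         (≤-trans (≤-reflexive (sym (∣⁅x⁆∣≡1 e))) (hall′ ⁅ e ⁆ (⁅⁆⊆ e∈I)))
    ... | i , i∈Γ with ∈Γ⁻ {N′} i∈Γ
    ... | y , y∈ , i∈ = i , λ _ → subst (λ z → i ∈ N′ z) (x∈⁅y⁆⇒x≡y e y∈) i∈

    φ : Fin n → Fin k
    φ e = proj₁ (choose e)

    φ∈ : ∀ e → e ∈ I → φ e ∈ N′ e
    φ∈ e = proj₂ (choose e)

    single : ∀ {e i} → i ∈ N′ e → N′ e ⊆ ⁅ i ⁆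
    single {e} {i} i∈ = ⊆-reflexive (sym (⊆∧∣∣≥⇒≡ (⁅⁆⊆ i∈)
      (≤-trans (≤1 (∈-allFin e)) (≤-reflexive (sym (∣⁅x⁆∣≡1 i))))))

    injective : ∀ e e′ → e ∈ I → e′ ∈ I → φ e ≡ φ e′ → e ≡ e′
    injective e e′ e∈I e′∈I φe≡φe′ with e ≟ e′
    ... | yes e≡e′ = e≡e′
    ... | no  e≢e′ = contradiction (begin-strict
      ∣ ⁅ φ e ⁆ ∣                ≡⟨ trans (∣⁅x⁆∣≡1 (φ e)) (sym (∣⁅x⁆∣≡1 e)) ⟩
      ∣ ⁅ e ⁆ ∣                  <⟨ ≤-refl ⟩
      suc ∣ ⁅ e ⁆ ∣              ≡⟨ x∉p⇒∣p∪⁅x⁆∣≡1+∣p∣ (x≢y⇒x∉⁅y⁆ (e≢e′ ∘ sym)) ⟨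
      ∣ ⁅ e ⁆ ∪ ⁅ e′ ⁆ ∣         ≤⟨ hall′ _ (∪-lub (⁅⁆⊆ e∈I) (⁅⁆⊆ e′∈I)) ⟩
      ∣ Γ N′ (⁅ e ⁆ ∪ ⁅ e′ ⁆) ∣  ≤⟨ p⊆q⇒∣p∣≤∣q∣ incl ⟩
      ∣ ⁅ φ e ⁆ ∣                ∎) (<-irrefl refl)
      where
      open ≤-Reasoning
      incl : Γ N′ (⁅ e ⁆ ∪ ⁅ e′ ⁆) ⊆ ⁅ φ e ⁆
      incl {l} l∈ with ∈Γ⁻ {N′} l∈
      ... | y , y∈ , l∈N′y with ∪-split y∈
      ... | inj₁ y∈e  = single (φ∈ e e∈I) (subst (λ z → l ∈ N′ z) (x∈⁅y⁆⇒x≡y e y∈e) l∈N′y)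
      ... | inj₂ y∈e′ = subst (λ z → l ∈ ⁅ z ⁆) (sym φe≡φe′)
                          (single (φ∈ e′ e′∈I) (subst (λ z → l ∈ N′ z) (x∈⁅y⁆⇒x≡y e′ y∈e′) l∈N′y))

-- Presentations from families of flats

module _ {A : Set} where

  -- Counting positions instead of entries respects multiplicities and makes the cardinality lemmas
  -- for subsets available.
  cnt : {P : Pred A 0ℓ} → Decidable P → List A → ℕ
  cnt P? xs = ∣ setOf (P? ∘ lookup xs) ∣

  module _ {P Q : Pred A 0ℓ} (P? : Decidable P) (Q? : Decidable Q) where

    cnt-mono : ∀ xs → (∀ {x} → x List.∈ xs → P x → Q x) → cnt P? xs ≤ cnt Q? xs
    cnt-mono xs P⇒Q = p⊆q⇒∣p∣≤∣q∣ λ {i} i∈ →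
      ∈-setOf⁺ (Q? ∘ lookup xs) (P⇒Q (∈-lookup i) (∈-setOf⁻ (P? ∘ lookup xs) i∈))

    cnt-submod : ∀ {S T : Pred A 0ℓ} (S? : Decidable S) (T? : Decidable T) xs →
      (∀ {x} → S x → P x ⊎ Q x) → (∀ {x} → T x → P x × Q x) →
      cnt S? xs + cnt T? xs ≤ cnt P? xs + cnt Q? xs
    cnt-submod S? T? xs S⇒ T⇒ = ≤-trans
      (+-mono-≤
        (p⊆q⇒∣p∣≤∣q∣ λ s∈ → [ ∪-inl ∘ ∈-setOf⁺ (P? ∘ lookup xs) , ∪-inr ∘ ∈-setOf⁺ (Q? ∘ lookup xs) ]′
          (S⇒ (∈-setOf⁻ (S? ∘ lookup xs) s∈)))
        (p⊆q⇒∣p∣≤∣q∣ λ t∈ → let p , q = T⇒ (∈-setOf⁻ (T? ∘ lookup xs) t∈) in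
          x∈p∩q⁺ (∈-setOf⁺ (P? ∘ lookup xs) p , ∈-setOf⁺ (Q? ∘ lookup xs) q)))
      (≤-reflexive (∣p∪q∣+∣p∩q∣≡∣p∣+∣q∣ (setOf (P? ∘ lookup xs)) (setOf (Q? ∘ lookup xs))))

  module _ {P : Pred A 0ℓ} (P? : Decidable P) where

    cnt-none : ∀ xs → (∀ {x} → ¬ P x) → cnt P? xs ≡ 0
    cnt-none xs ¬P = trans
      (cong ∣_∣ (Empty-unique λ (i , i∈) → ¬P (∈-setOf⁻ (P? ∘ lookup xs) i∈))) (∣⊥∣≡0 (length xs))

    cnt-all : ∀ xs → (∀ {x} → x List.∈ xs → P x) → cnt P? xs ≡ length xs
    cnt-all xs all = trans
      (cong ∣_∣ (⊆-antisym ⊆⊤ λ {i} _ → ∈-setOf⁺ (P? ∘ lookup xs) (all (∈-lookup i)))) (∣⊤∣≡n (length xs))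

    cnt-¬ : ∀ xs → cnt (¬? ∘ P?) xs + cnt P? xs ≡ length xs
    cnt-¬ []       = refl
    cnt-¬ (x ∷ xs) with does (P? x)
    ... | true  = trans (+-suc _ _) (cong suc (cnt-¬ xs))
    ... | false = cong suc (cnt-¬ xs)

    cnt-∷-yes : ∀ {x} xs → P x → cnt P? (x ∷ xs) ≡ suc (cnt P? xs)
    cnt-∷-yes {x} xs px rewrite dec-true (P? x) px = refl

    cnt-∷-no : ∀ {x} xs → ¬ P x → cnt P? (x ∷ xs) ≡ cnt P? xs
    cnt-∷-no {x} xs ¬px rewrite dec-false (P? x) ¬px = refl

    cnt-replicate-yes : ∀ b {x} xs → P x → cnt P? (replicate b x ++ xs) ≡ b + cnt P? xs
    cnt-replicate-yes zero    xs px = refl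
    cnt-replicate-yes (suc b) xs px =
      trans (cnt-∷-yes (replicate b _ ++ xs) px) (cong suc (cnt-replicate-yes b xs px))

    cnt-replicate-no : ∀ b {x} xs → ¬ P x → cnt P? (replicate b x ++ xs) ≡ cnt P? xs
    cnt-replicate-no zero    xs ¬px = refl
    cnt-replicate-no (suc b) xs ¬px =
      trans (cnt-∷-no (replicate b _ ++ xs) ¬px) (cnt-replicate-no b xs ¬px)

Incomparable : ∀ {n} → Subset n → Subset n → Set
Incomparable A B = A ⊈ B × B ⊈ A

∁-incomparable : ∀ {n} {A B : Subset n} → Incomparable A B → Incomparable (∁ A) (∁ B)
∁-incomparable (A⊈B , B⊈A) = (λ ∁A⊆∁B → B⊈A (∁p⊆∁q⇒p⊇q ∁A⊆∁B)) , λ ∁B⊆∁A → A⊈B (∁p⊆∁q⇒p⊇q ∁B⊆∁A)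

-- What the construction of a presentation needs from the flats. The order is on indices because
-- different indices may give the same set. In `exchange`, `W` stands for a common lower bound of
-- all members from `b` to `l`, and the rank inequality for the inclusion of `F b` in the closure of
-- `F a ∪ W`. By `dependent`, every dependent set is already too large inside some member.
record StaircaseFamily {n m} (R : RankFunction n) (F : Fin m → Subset n) : Set₁ where
  open RankFunction R
  field
    _≺_       : Fin m → Fin m → Set
    ≺-refl    : ∀ {a} → a ≺ a
    ≺-trans   : ∀ {a b c} → a ≺ b → b ≺ c → a ≺ c
    compare   : ∀ a b → (F a ⊆ F b ⊎ F b ⊆ F a) ⊎ (a ≺ b ⊎ b ≺ a)
    joins     : ∀ a b → ∃ λ j → F a ⊆ F j × F b ⊆ F j × r (F j) ≤ r (F a ∪ F b)
    exchange  : ∀ {a b l} → a ≺ b → b ≺ l → Incomparable (F a) (F b) →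
                Incomparable (F b) (F l) → Incomparable (F a) (F l) →
                ∃ λ W → (∀ {c} → b ≺ c → c ≺ l → W ⊆ F c) × r (F a ∪ F b) ≤ r (F a ∪ W)
    least     : ∃ λ o → r (F o) ≡ 0 × (∀ a → F o ⊆ F a)
    dependent : ∀ I → r I < ∣ I ∣ → ∃ λ a → r (F a) < ∣ I ∩ F a ∣

module _ {n m} {R : RankFunction n} {F : Fin m → Subset n} (family : StaircaseFamily R F) where
  open RankFunction R
  open StaircaseFamily family

  up : Subset n → List (Subset n) → ℕ
  up Y P = cnt (Y ⊆?_) P

  above? : ∀ As → Decidable (λ S → Any (λ a → F a ⊆ S) As)
  above? As S = Any.any? (λ a → F a ⊆? S) As

  ⋂F : List (Fin m) → Subset n
  ⋂F = foldr (λ a Y → F a ∩ Y) ⊤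

  ⋂F-glb : ∀ {W} As → (∀ {a} → a List.∈ As → W ⊆ F a) → W ⊆ ⋂F As
  ⋂F-glb []       _  = ⊆⊤
  ⋂F-glb (_ ∷ As) W⊆ = ∩-glb (W⊆ (here refl)) (⋂F-glb As (λ a∈ → W⊆ (there a∈)))

  infix 4 _⋖_
  _⋖_ : Fin m → Fin m → Set
  a ⋖ b = a ≺ b × Incomparable (F a) (F b)

  last : ∀ {b bs} → AllPairs _⋖_ (b ∷ bs) → ∃ λ l → l List.∈ b ∷ bs × All (_≺ l) (b ∷ bs)
  last {b} {[]}    _                     = b , here refl , ≺-refl ∷ []
  last {b} {_ ∷ _} (b⋖ ∷ sorted) with last sorted
  ... | l , l∈ , ≺l = l , there l∈ , proj₁ (All.lookup b⋖ l∈) ∷ ≺l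

  -- In a sorted antichain every entry of `b ∷ bs` lies between `b` and the last entry `l`. Hence
  -- the set `W` that `exchange` provides for `a`, `b`, `l` is contained in the whole intersection.
  exchange-sorted : ∀ {a b bs} → AllPairs _⋖_ (a ∷ b ∷ bs) →
                    r (F a ∪ F b) ≤ r (F a ∪ ⋂F (b ∷ bs))
  exchange-sorted {bs = []} _ = mono (∪-mono id (∩-glb id ⊆⊤))
  exchange-sorted {a} {b} {_ ∷ _} ((a⋖b ∷ a⋖) ∷ b⋖ ∷ sorted) with last sorted
  ... | l , l∈ , ≺l with exchange (proj₁ a⋖b) (proj₁ b⋖l) (proj₂ a⋖b) (proj₂ b⋖l)
                           (proj₂ (All.lookup a⋖ l∈))
    where
    b⋖l : b ⋖ l
    b⋖l = All.lookup b⋖ l∈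
  ... | W , W⊆ , r≤ = ≤-trans r≤ (mono (∪-mono id (⋂F-glb _ λ
    { (here refl) → W⊆ ≺-refl (proj₁ (All.lookup b⋖ l∈))
    ; (there c∈)  → W⊆ (proj₁ (All.lookup b⋖ c∈)) (All.lookup ≺l c∈) })))

  insert : ∀ x As → AllPairs _⋖_ As → All (λ a → Incomparable (F x) (F a)) As →
    ∃ λ Bs → AllPairs _⋖_ Bs × (∀ {b} → b List.∈ Bs → b ≡ x ⊎ b List.∈ As)
           × x List.∈ Bs × (∀ {a} → a List.∈ As → a List.∈ Bs)
  insert x [] _ _ = x ∷ [] , [] ∷ [] , (λ { (here refl) → inj₁ refl }) , here refl , λ ()
  insert x (a ∷ As) (a⋖ ∷ sorted) (x∥a ∷ x∥) with compare x a
  ... | inj₁ (inj₁ x⊆a) = ⊥-elim (proj₁ x∥a x⊆a)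
  ... | inj₁ (inj₂ a⊆x) = ⊥-elim (proj₂ x∥a a⊆x)
  ... | inj₂ (inj₁ x≺a) = x ∷ a ∷ As
      , ((x≺a , x∥a) ∷ All.zipWith (λ ((a≺b , _) , x∥b) → ≺-trans x≺a a≺b , x∥b) (a⋖ , x∥)) ∷ a⋖ ∷ sorted
      , (λ { (here refl) → inj₁ refl ; (there b∈) → inj₂ b∈ }) , here refl , there
  ... | inj₂ (inj₂ a≺x) with insert x As sorted x∥
  ... | Bs , sortedB , from , x∈ , to = a ∷ Bs
      , All.tabulate (λ b∈ → [ (λ { refl → a≺x , proj₂ x∥a , proj₁ x∥a }) , All.lookup a⋖ ]′ (from b∈)) ∷ sortedB
      , (λ { (here refl) → inj₂ (here refl) ; (there b∈) → [ inj₁ , inj₂ ∘ there ]′ (from b∈) })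
      , there x∈
      , λ { (here refl) → here refl ; (there c∈) → there (to c∈) }

  -- The minimal members of `L` generate the same up-set as `L`, and being incomparable they can be
  -- sorted by means of `compare`.
  minimal-antichain : ∀ L → ∃ λ As → AllPairs _⋖_ As × (∀ {a} → a List.∈ As → a List.∈ L)
                    × (∀ {a} → a List.∈ L → ∃ λ b → b List.∈ As × F b ⊆ F a)
  minimal-antichain []      = [] , [] , (λ ()) , λ ()
  minimal-antichain (x ∷ L) with minimal-antichain L
  ... | As , sorted , sub , dom with Any.any? (λ a → F a ⊆? F x) As
  ... | yes below = As , sorted , there ∘ sub , λ
        { (here refl) → let b , b∈ , b⊆x = List.find below in b , b∈ , b⊆x
        ; (there a∈) → dom a∈ }
  ... | no ¬below with insert x (filter (λ a → ¬? (F x ⊆? F a)) As)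
                         (AllPairs.filter⁺ (λ a → ¬? (F x ⊆? F a)) sorted)
                         (All.tabulate λ a∈ → let a∈As , x⊈a = ∈-filter⁻ (λ a → ¬? (F x ⊆? F a)) a∈ in
                           x⊈a , λ a⊆x → ¬below (List.lose a∈As a⊆x))
  ... | Bs , sortedB , from , x∈ , to = Bs , sortedB
      , (λ b∈ → [ here , there ∘ sub ∘ proj₁ ∘ ∈-filter⁻ (λ a → ¬? (F x ⊆? F a)) ]′ (from b∈))
      , λ { (here refl) → x , x∈ , id ; (there a∈) → dominated a∈ }
    where
    dominated : ∀ {a} → a List.∈ L → ∃ λ b → b List.∈ Bs × F b ⊆ F a
    dominated a∈ with dom a∈
    ... | b , b∈ , b⊆a with F x ⊆? F b
    ... | yes x⊆b = x , x∈ , b⊆a ∘ x⊆b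
    ... | no  x⊈b = b , to (∈-filter⁺ (λ a → ¬? (F x ⊆? F a)) b∈ x⊈b) , b⊆a

  module _ (P : List (Subset n)) (D : Fin m → Set)
    (up≤ : ∀ {a} → D a → up (F a) P + r (F a) ≤ r ⊤)
    (up≥ : ∀ {a b} → D a → D b → Incomparable (F a) (F b) →
           r ⊤ ≤ up (F a ∪ F b) P + r (F a ∪ F b))
    where

    -- Adjoin `a` to `b ∷ bs` by inclusion and exclusion. The sets above both `a` and some later
    -- entry include those above `F a ∪ F b`, of which there are at least `r ⊤` minus the rank of
    -- that union. By `exchange-sorted` and submodularity this rank plus that of the new
    -- intersection is at most the sum of the ranks of `F a` and the old intersection, which is the
    -- correction required.
    sorted-bound : ∀ As → AllPairs _⋖_ As → All D As → cnt (above? As) P + r (⋂F As) ≤ r ⊤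
    sorted-bound [] _ _ = ≤-reflexive (cong (_+ r ⊤) (cnt-none (above? []) P λ ()))
    sorted-bound (a ∷ []) _ (da ∷ []) = ≤-trans
      (+-mono-≤ (cnt-mono (above? (a ∷ [])) (F a ⊆?_) P (λ { _ (here a⊆S) → a⊆S })) (mono ∩-prl))
      (up≤ da)
    sorted-bound (a ∷ b ∷ bs) sorted@((a⋖b ∷ _) ∷ sorted′) (da ∷ db ∷ dbs) =
      arith (cnt (above? (a ∷ b ∷ bs)) P) (up (F a ∪ F b) P) (up (F a) P) (cnt (above? (b ∷ bs)) P)
            (r (F a ∪ F b)) (r (⋂F (a ∷ b ∷ bs))) (r (F a)) (r (⋂F (b ∷ bs))) (r ⊤)
            (cnt-submod (F a ⊆?_) (above? (b ∷ bs)) (above? (a ∷ b ∷ bs)) ((F a ∪ F b) ⊆?_) P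
               (λ { (here a⊆S) → inj₁ a⊆S ; (there any) → inj₂ any })
               (λ ab⊆S → ab⊆S ∘ ∪-inl , here (ab⊆S ∘ ∪-inr)))
            (up≥ da db (proj₂ a⋖b)) (up≤ da) (sorted-bound (b ∷ bs) sorted′ (db ∷ dbs))
            (≤-trans (+-monoˡ-≤ _ (exchange-sorted sorted)) (submod (F a) (⋂F (b ∷ bs)) id ∩-prl ∩-prr))
      where
      arith : ∀ u k p q ab x ra ri t → u + k ≤ p + q → t ≤ k + ab → p + ra ≤ t → q + ri ≤ t →
              ab + x ≤ ra + ri → u + x ≤ t
      arith u k p q ab x ra ri t h₁ h₂ h₃ h₄ h₅ =
        +-cancelʳ-≤ (k + t + p + ra + q + ri + ab) _ _ (begin
          u + x + (k + t + p + ra + q + ri + ab)              ≡⟨ left u k p q ab x ra ri t ⟩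
          u + k + t + (p + ra) + (q + ri) + (ab + x)          ≤⟨ +-mono-≤ (+-mono-≤ (+-mono-≤ (+-mono-≤ h₁ h₂) h₃) h₄) h₅ ⟩
          (p + q) + (k + ab) + t + t + (ra + ri)              ≡⟨ right k p q ab ra ri t ⟩
          t + (k + t + p + ra + q + ri + ab)                  ∎)
        where
        open ≤-Reasoning
        left : ∀ u k p q ab x ra ri t → u + x + (k + t + p + ra + q + ri + ab) ≡
               u + k + t + (p + ra) + (q + ri) + (ab + x)
        left = solve-∀
        right : ∀ k p q ab ra ri t → (p + q) + (k + ab) + t + t + (ra + ri) ≡
                t + (k + t + p + ra + q + ri + ab)
        right = solve-∀

    upset-bound : ∀ L Y → (∀ {a} → a List.∈ L → D a × Y ⊆ F a) → cnt (above? L) P + r Y ≤ r ⊤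
    upset-bound L Y L⇒ with minimal-antichain L
    ... | As , sorted , sub , dom = ≤-trans
      (+-mono-≤
        (cnt-mono (above? L) (above? As) P λ _ any →
          let a , a∈ , a⊆S = List.find any ; b , b∈ , b⊆a = dom a∈ in List.lose b∈ (a⊆S ∘ b⊆a))
        (mono (⋂F-glb As λ a∈ → proj₂ (L⇒ (sub a∈)))))
      (sorted-bound As sorted (All.tabulate (proj₁ ∘ L⇒ ∘ sub)))

  module _ (xs : List (Fin m)) where

    record Presents (P : List (Subset n)) : Set where
      field
        exact   : ∀ {a} → a List.∈ xs → up (F a) P + r (F a) ≡ r ⊤
        members : ∀ {S} → S List.∈ P → ∃ λ a → a List.∈ xs × S ≡ F a

    -- Being closed upwards, expressed by sizes so that a list sorted by size can supply it: a
    -- member that contains one from `xs` is itself in `xs`, or else is not larger and so is the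
    -- same set.
    UpClosed : Set
    UpClosed = ∀ j → j List.∈ xs ⊎ All (λ a → ∣ F j ∣ ≤ ∣ F a ∣) xs

    module _ {P} (presents : Presents P) (closed : UpClosed) where
      open Presents presents

      -- The join of two incomparable members is strictly larger than both, so it belongs to `xs`,
      -- and the count above it is known exactly.
      up-join≥ : ∀ {a b} → a List.∈ xs → b List.∈ xs → Incomparable (F a) (F b) →
                 r ⊤ ≤ up (F a ∪ F b) P + r (F a ∪ F b)
      up-join≥ {a} {b} a∈ b∈ (_ , b⊈a) with joins a b
      ... | j , a⊆j , b⊆j , rj≤ with closed j
      ... | inj₁ j∈ = ≤-trans (≤-reflexive (sym (exact j∈)))
              (+-mono-≤ (cnt-mono (F j ⊆?_) ((F a ∪ F b) ⊆?_) P λ _ j⊆S → j⊆S ∘ ∪-lub a⊆j b⊆j) rj≤)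
      ... | inj₂ small = ⊥-elim (b⊈a (subst (F b ⊆_)
              (sym (⊆∧∣∣≥⇒≡ a⊆j (All.lookup small a∈))) b⊆j))

      -- Each set of `P` containing `Y` is a member from `xs` containing `Y`, so it lies in the
      -- up-set generated by such members. The bound serves twice: for nonnegativity of the next
      -- multiplicity and for Hall's condition.
      up-bound : ∀ Y → up Y P + r Y ≤ r ⊤
      up-bound Y = ≤-trans
        (+-monoˡ-≤ (r Y) (cnt-mono (Y ⊆?_) (above? L) P λ S∈ Y⊆S →
          let a , a∈ , S≡ = members S∈ in
          List.lose (∈-filter⁺ (λ a → Y ⊆? F a) a∈ (subst (Y ⊆_) S≡ Y⊆S)) (⊆-reflexive (sym S≡))))
        (upset-bound P (List._∈ xs) (≤-reflexive ∘ exact) up-join≥ L Y (∈-filter⁻ (λ a → Y ⊆? F a)))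
        where
        L : List (Fin m)
        L = filter (λ a → Y ⊆? F a) xs

  -- The list is sorted by increasing size and its tail is treated first, so multiplicities are
  -- assigned from the largest members downwards.
  present : ∀ xs → AllPairs (λ a b → ∣ F a ∣ ≤ ∣ F b ∣) xs → UpClosed xs → ∃ (Presents xs)
  present [] _ _ = [] , record { exact = λ () ; members = λ () }
  present (x ∷ xs) (x≤ ∷ sorted) closed = P′ , record { exact = exact′ ; members = members′ }
    where
    closed′ : UpClosed xs
    closed′ j with closed j
    ... | inj₁ (here refl)  = inj₂ x≤
    ... | inj₁ (there j∈)   = inj₁ j∈
    ... | inj₂ (_ ∷ small)  = inj₂ small

    prev : ∃ (Presents xs)
    prev = present xs sorted closed′

    P P′ : List (Subset n)
    P = proj₁ prev

    open Presents (proj₂ prev)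

    -- The multiplicity forced on `F x`; `up-bound` at `F x` shows that the subtraction does not
    -- truncate.
    β : ℕ
    β = r ⊤ ∸ (up (F x) P + r (F x))

    P′ = replicate β (F x) ++ P

    exact-x : up (F x) P′ + r (F x) ≡ r ⊤
    exact-x = trans (cong (_+ r (F x)) (cnt-replicate-yes (F x ⊆?_) β P id))
      (trans (+-assoc β _ _) (m∸n+n≡m (up-bound xs (proj₂ prev) closed′ (F x))))

    exact′ : ∀ {a} → a List.∈ x ∷ xs → up (F a) P′ + r (F a) ≡ r ⊤
    exact′ (here refl) = exact-x
    exact′ {a} (there a∈) with F a ⊆? F x
    -- The new copies affect only members inside `F x`; since `F x` has the least size, such a
    -- member equals `F x`.
    ... | yes a⊆x = subst (λ Y → up Y P′ + r Y ≡ r ⊤) (sym (⊆∧∣∣≥⇒≡ a⊆x (All.lookup x≤ a∈))) exact-x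
    ... | no  a⊈x = trans (cong (_+ r (F a)) (cnt-replicate-no (F a ⊆?_) β P a⊈x)) (exact a∈)

    members′ : ∀ {S} → S List.∈ P′ → ∃ λ a → a List.∈ x ∷ xs × S ≡ F a
    members′ S∈ with ∈-++⁻ (replicate β (F x)) S∈
    ... | inj₁ S∈rep = x , here refl , All.lookup (All.replicate⁺ {P = _≡ F x} β refl) S∈rep
    ... | inj₂ S∈P   = let a , a∈ , S≡ = members S∈P in a , there a∈ , S≡

  private
    bySize = On.decTotalOrder ≤-decTotalOrder (λ a → ∣ F a ∣)
    open Sort bySize using (sort; sort-↭; sort-↗)

    indices : List (Fin m)
    indices = sort (allFin m)

    every : ∀ a → a List.∈ indices
    every a = Permₚ.∈-resp-↭ (Perm.↭-sym (sort-↭ (allFin m))) (∈-allFin a)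

    indices-closed : UpClosed indices
    indices-closed = inj₁ ∘ every

    presentation : ∃ (Presents indices)
    presentation = present indices
      (Linked⇒AllPairs (λ {a} {b} {c} → ≤-trans {∣ F a ∣} {∣ F b ∣} {∣ F c ∣}) (sort-↗ (allFin m)))
      indices-closed

    P : List (Subset n)
    P = proj₁ presentation

    open Presents (proj₂ presentation)

    -- Every set of `P` lies above the least member, whose rank is zero.
    ∣P∣≡r⊤ : length P ≡ r ⊤
    ∣P∣≡r⊤ with least
    ... | o , ro≡0 , o⊆ = trans
      (sym (cnt-all (F o ⊆?_) P λ S∈ → let a , _ , S≡ = members S∈ in subst (F o ⊆_) (sym S≡) (o⊆ a)))
      (trans (sym (trans (cong (up (F o) P +_) ro≡0) (+-identityʳ _))) (exact (every o)))

    -- The extra set ⊤ has empty complement; it only makes the index type of A inhabited.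
    Q : List (Subset n)
    Q = ⊤ ∷ P

    -- The number of sets of the presentation that meet `Y`, since `Y` meets `∁ S` exactly when it
    -- is not contained in `S`.
    meeting : Subset n → ℕ
    meeting Y = cnt (λ S → ¬? (Y ⊆? S)) Q

    meeting+up : ∀ Y → meeting Y + up Y P ≡ r ⊤
    meeting+up Y = trans
      (cong (_+ up Y P) (cnt-∷-no (λ S → ¬? (Y ⊆? S)) P (λ ¬⊆ → ¬⊆ ⊆⊤)))
      (trans (cnt-¬ (Y ⊆?_) P) ∣P∣≡r⊤)

    r≤meeting : ∀ Y → r Y ≤ meeting Y
    r≤meeting Y = +-cancelˡ-≤ (up Y P) _ _ (begin
      up Y P + r Y        ≤⟨ up-bound indices (proj₂ presentation) indices-closed Y ⟩
      r ⊤                 ≡⟨ meeting+up Y ⟨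
      meeting Y + up Y P  ≡⟨ +-comm (meeting Y) _ ⟩
      up Y P + meeting Y  ∎)
      where open ≤-Reasoning

    meeting-F : ∀ a → meeting (F a) ≡ r (F a)
    meeting-F a = +-cancelˡ-≡ (up (F a) P) _ _
      (trans (+-comm (up (F a) P) _) (trans (meeting+up (F a)) (sym (exact (every a)))))

  family-sets : Fin (suc (length P)) → Subset n
  family-sets i = ∁ (lookup Q i)

  -- A subset `Y` of an independent set satisfies Hall's condition because its size is at most
  -- `r Y`, hence at most `meeting Y`. Conversely a dependent set has more than `r (F a)` elements
  -- in some `F a`, which only `r (F a)` sets of the presentation meet.
  family-transversal : ∀ I → ∣ I ∣ ≤ r I ⇔ PartialTransversal family-sets I
  family-transversal I = mk⇔ to from
    where
    open ≤-Reasoning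

    N : Fin n → Subset (suc (length P))
    N y = setOf (λ i → y ∈? family-sets i)

    meeting⊆Γ : ∀ Y → setOf (λ i → ¬? (Y ⊆? lookup Q i)) ⊆ Γ N Y
    meeting⊆Γ Y {i} i∈ =
      let y , y∈Y , y∉S = ⊈⇒∃ (∈-setOf⁻ (λ i → ¬? (Y ⊆? lookup Q i)) i∈) in
      ∈Γ⁺ {N = N} y∈Y (∈-setOf⁺ (λ i → y ∈? family-sets i) (x∉p⇒x∈∁p y∉S))

    to : ∣ I ∣ ≤ r I → PartialTransversal family-sets I
    to indep =
      let φ , into , inj = marriage zero N I hall in
      φ , (λ e e∈I → ∈-setOf⁻ (λ i → e ∈? family-sets i) (into e e∈I)) , inj
      where
      hall : HallCondition N I
      hall Y Y⊆I = begin
        ∣ Y ∣        ≤⟨ +-cancelʳ-≤ ∣ I ─ Y ∣ _ _ (begin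
          ∣ Y ∣ + ∣ I ─ Y ∣   ≡⟨ q⊆p⇒∣p∣≡∣q∣+∣p─q∣ Y⊆I ⟨
          ∣ I ∣               ≤⟨ indep ⟩
          r I                 ≤⟨ r-⊆∪ Y (I ─ Y) (∪-mono ∩-prr id ∘ ─∪-cover) ⟩
          r Y + ∣ I ─ Y ∣     ∎) ⟩
        r Y          ≤⟨ r≤meeting Y ⟩
        meeting Y    ≤⟨ p⊆q⇒∣p∣≤∣q∣ (meeting⊆Γ Y) ⟩
        ∣ Γ N Y ∣    ∎

    from : PartialTransversal family-sets I → ∣ I ∣ ≤ r I
    from (φ , into , inj) = ≮⇒≥ λ lt → let a , ra< = dependent I lt in
      <-irrefl refl (begin-strict
        r (F a)          <⟨ ra< ⟩
        ∣ I ∩ F a ∣      ≤⟨ injectiveOn⇒∣∣≤ φ (I ∩ F a) (setOf (λ i → ¬? (F a ⊆? lookup Q i)))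
                              (λ x x∈ → ∈-setOf⁺ (λ i → ¬? (F a ⊆? lookup Q i)) λ Fa⊆ →
                                x∈∁p⇒x∉p (into x (∩-prl x∈)) (Fa⊆ (∩-prr x∈)))
                              (λ x y x∈ y∈ → inj x y (∩-prl x∈) (∩-prl y∈)) ⟩
        meeting (F a)    ≡⟨ meeting-F a ⟩
        r (F a)          ∎)

-- Contractions

allSubsets : ∀ n → List (Subset n)
allSubsets zero    = [] ∷ []
allSubsets (suc n) = map (inside ∷_) (allSubsets n) ++ map (outside ∷_) (allSubsets n)

∈-allSubsets : ∀ {n} (S : Subset n) → S List.∈ allSubsets n
∈-allSubsets []            = here refl
∈-allSubsets (inside  ∷ S) = ∈-++⁺ˡ (∈-map⁺ (inside ∷_) (∈-allSubsets S))
∈-allSubsets (outside ∷ S) = ∈-++⁺ʳ _ (∈-map⁺ (outside ∷_) (∈-allSubsets S))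

-- The condition on the uncontracted matroid. Here `exchange` asks for an inclusion in a closure,
-- which, unlike a rank inequality, persists when `X` is adjoined.
record Staircase {n} (R : RankFunction n) : Set₁ where
  open RankFunction R
  field
    _≺_      : Subset n → Subset n → Set
    ≺-refl   : ∀ {A} → A ≺ A
    ≺-trans  : ∀ {A B C} → A ≺ B → B ≺ C → A ≺ C
    compare  : ∀ {A B} → IsCyclicFlat A → IsCyclicFlat B → (A ⊆ B ⊎ B ⊆ A) ⊎ (A ≺ B ⊎ B ≺ A)
    exchange : ∀ {A B L} → IsCyclicFlat A → IsCyclicFlat B → IsCyclicFlat L → A ≺ B → B ≺ L →
               Incomparable A B → Incomparable B L → Incomparable A L →
               ∃ λ W → (∀ {C} → IsCyclicFlat C → B ≺ C → C ≺ L → W ⊆ C) × B ⊆ cl (A ∪ W)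

module _ {n} {R : RankFunction n} (staircase : Staircase R) (X : Subset n) where
  open RankFunction R
  private
    module S = Staircase staircase
    module R/X = RankFunction (contractRank R X)

    flats : List (Subset n)
    flats = filter cyclicFlat? (allSubsets n)

    G F : Fin (length flats) → Subset n
    G a = lookup flats a
    F a = cl (G a ∪ X)

    G-cyclicFlat : ∀ a → IsCyclicFlat (G a)
    G-cyclicFlat a = proj₂ (∈-filter⁻ cyclicFlat? {xs = allSubsets n} (∈-lookup a))

    index : ∀ {A} → IsCyclicFlat A → ∃ λ a → A ≡ G a
    index {A} cf = let A∈ = ∈-filter⁺ cyclicFlat? (∈-allSubsets A) cf in Any.index A∈ , lookup-index A∈

    G⊆F : ∀ a → G a ⊆ F a
    G⊆F a = ⊆cl ∘ ∪-inl

    F-mono : ∀ {a b} → G a ⊆ G b → F a ⊆ F b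
    F-mono Ga⊆Gb = cl-mono (∪-mono Ga⊆Gb id)

    G-incomparable : ∀ {a b} → Incomparable (F a) (F b) → Incomparable (G a) (G b)
    G-incomparable (a⊈b , b⊈a) = (λ a⊆b → a⊈b (F-mono a⊆b)) , λ b⊆a → b⊈a (F-mono b⊆a)

    r/X-≤ : ∀ {U V} → U ⊆ cl (V ∪ X) → R/X.r U ≤ R/X.r V
    r/X-≤ U⊆ = ∸-monoˡ-≤ (r X) (r-⊆cl (∪-lub U⊆ (⊆cl ∘ ∪-inr)))

    compare : ∀ a b → (F a ⊆ F b ⊎ F b ⊆ F a) ⊎ (G a S.≺ G b ⊎ G b S.≺ G a)
    compare a b with S.compare (G-cyclicFlat a) (G-cyclicFlat b)
    ... | inj₁ (inj₁ a⊆b) = inj₁ (inj₁ (F-mono {a} {b} a⊆b))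
    ... | inj₁ (inj₂ b⊆a) = inj₁ (inj₂ (F-mono {b} {a} b⊆a))
    ... | inj₂ a≺≻b       = inj₂ a≺≻b

    joins : ∀ a b → ∃ λ j → F a ⊆ F j × F b ⊆ F j × R/X.r (F j) ≤ R/X.r (F a ∪ F b)
    joins a b with index (cl-cyclicFlat (∪-cyclic (proj₂ (G-cyclicFlat a)) (proj₂ (G-cyclicFlat b))))
    ... | j , J≡ = j , F-mono (subst (G a ⊆_) J≡ (⊆cl ∘ ∪-inl)) , F-mono (subst (G b ⊆_) J≡ (⊆cl ∘ ∪-inr))
      , r/X-≤ (cl-least (∪-lub
          (subst (_⊆ cl ((F a ∪ F b) ∪ X)) J≡ (cl-mono (∪-inl ∘ ∪-mono (G⊆F a) (G⊆F b))))
          (⊆cl ∘ ∪-inr)) cl-flat)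

    exchange : ∀ {a b l} → G a S.≺ G b → G b S.≺ G l → Incomparable (F a) (F b) →
               Incomparable (F b) (F l) → Incomparable (F a) (F l) →
               ∃ λ W → (∀ {c} → G b S.≺ G c → G c S.≺ G l → W ⊆ F c) ×
                       R/X.r (F a ∪ F b) ≤ R/X.r (F a ∪ W)
    exchange {a} {b} {l} a≺b b≺l a∥b b∥l a∥l
      with S.exchange (G-cyclicFlat a) (G-cyclicFlat b) (G-cyclicFlat l) a≺b b≺l
             (G-incomparable {a} {b} a∥b) (G-incomparable {b} {l} b∥l) (G-incomparable {a} {l} a∥l)
    ... | W , W⊆ , B⊆ = W , (λ {c} b≺c c≺l → G⊆F c ∘ W⊆ (G-cyclicFlat c) b≺c c≺l)
      , r/X-≤ (∪-lub (⊆cl ∘ ∪-inl ∘ ∪-inl)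
          (cl-least (∪-lub (cl-mono (∪-inl ∘ ∪-mono (G⊆F a) id) ∘ B⊆) (⊆cl ∘ ∪-inr)) cl-flat))

    -- The least cyclic flat is the closure of the empty set; its elements are loops, so joining it
    -- to `X` adds no rank.
    least : ∃ λ o → R/X.r (F o) ≡ 0 × (∀ a → F o ⊆ F a)
    least with index (cl-cyclicFlat {⊥} (⊥-elim ∘ ∉⊥))
    ... | o , O≡ = o
      , m≤n⇒m∸n≡0 (r-⊆cl (∪-lub (cl-least (∪-lub
          (subst (_⊆ cl X) O≡ (cl-mono (⊥-elim ∘ ∉⊥))) ⊆cl) cl-flat) ⊆cl))
      , λ a → F-mono (subst (_⊆ G a) O≡ (cl-least (⊥-elim ∘ ∉⊥) (proj₁ (G-cyclicFlat a))))

    -- Let `G a` be the closure of the cyclic part `K` of `I ∪ X`. Then `K ∪ X` spans `F a`, and the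
    -- rest `T` of `I` consists of isthmuses of `I ∪ X`. These account for equal amounts of size and
    -- rank, so the deficiency of `I` already appears inside `F a`.
    dependent : ∀ I → R/X.r I < ∣ I ∣ → ∃ λ a → R/X.r (F a) < ∣ I ∩ F a ∣
    dependent I lt with index (cl-cyclicFlat (cyc-cyclic {I ∪ X}))
    ... | a , clK≡ = a , +-cancelʳ-< (r X + ∣ T ∣) _ _ (begin-strict
      R/X.r (F a) + (r X + ∣ T ∣)    ≡⟨ +-assoc (R/X.r (F a)) _ _ ⟨
      R/X.r (F a) + r X + ∣ T ∣      ≡⟨ cong (_+ ∣ T ∣) (contractRank-≡ R X (F a)) ⟩
      r (F a ∪ X) + ∣ T ∣            ≤⟨ +-monoˡ-≤ ∣ T ∣ (r-⊆cl (∪-lub Fa⊆ (⊆cl ∘ ∪-inr))) ⟩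
      r Y + ∣ T ∣                    ≤⟨ isthmuses-additive Y T (x∈p─q⇒x∉q I Y) isthmus ⟩
      r (Y ∪ T)                      ≤⟨ mono Y∪T⊆ ⟩
      r (I ∪ X)                      ≡⟨ contractRank-≡ R X I ⟨
      R/X.r I + r X                  <⟨ +-monoˡ-< (r X) lt ⟩
      ∣ I ∣ + r X                    ≡⟨ cong (_+ r X) (∣p∣≡∣p∩q∣+∣p─q∣ I Y) ⟩
      ∣ I ∩ Y ∣ + ∣ T ∣ + r X        ≡⟨ shift ∣ I ∩ Y ∣ _ _ ⟩
      ∣ I ∩ Y ∣ + (r X + ∣ T ∣)      ≤⟨ +-monoˡ-≤ (r X + ∣ T ∣) (p⊆q⇒∣p∣≤∣q∣ {p = I ∩ Y} (∩-glb ∩-prl (Y⊆Fa ∘ ∩-prr))) ⟩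
      ∣ I ∩ F a ∣ + (r X + ∣ T ∣)    ∎)
      where
      open ≤-Reasoning
      K Y T : Subset n
      K = cyc (I ∪ X)
      Y = K ∪ X
      T = I ─ Y
      shift : ∀ a b c → a + b + c ≡ a + (c + b)
      shift = solve-∀
      Fa⊆ : F a ⊆ cl Y
      Fa⊆ = cl-least (∪-lub (subst (_⊆ cl Y) clK≡ (cl-mono ∪-inl)) (⊆cl ∘ ∪-inr)) cl-flat
      Y⊆Fa : Y ⊆ F a
      Y⊆Fa = ⊆cl ∘ ∪-mono (subst (K ⊆_) clK≡ ⊆cl) id
      Y∪T⊆ : Y ∪ T ⊆ I ∪ X
      Y∪T⊆ = ∪-lub (∪-lub cyc⊆ ∪-inr) (∪-inl ∘ p─q⊆p I Y)
      ⊆Y∪T : I ∪ X ⊆ Y ∪ T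
      ⊆Y∪T = ∪-lub (∪-mono ∩-prr id ∘ ─∪-cover) (∪-inl ∘ ∪-inr)
      isthmus : ∀ {e} → e ∈ T → r ((Y ∪ T) - e) < r (Y ∪ T)
      isthmus {e} e∈T = ≰⇒> λ le → x∈p─q⇒x∉q I Y e∈T (∪-inl (∈cyc⁺ (∪-inl (p─q⊆p I Y e∈T))
        (≤-trans (mono ⊆Y∪T) (≤-trans le (mono (-‿mono Y∪T⊆))))))

    family : StaircaseFamily (contractRank R X) F
    family = record
      { _≺_       = λ a b → G a S.≺ G b
      ; ≺-refl    = S.≺-refl
      ; ≺-trans   = S.≺-trans
      ; compare   = compare
      ; joins     = joins
      ; exchange  = exchange
      ; least     = least
      ; dependent = dependent
      }

  contraction-transversal : ∃ λ k → Σ (Fin k → Subset n) λ A →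
    ∀ I → ∣ I ∣ + r X ≤ r (I ∪ X) ⇔ PartialTransversal A I
  contraction-transversal = _ , family-sets family , λ I → mk⇔
    (λ le → Equivalence.to (family-transversal family I)
      (+-cancelʳ-≤ (r X) _ _ (≤-trans le (≤-reflexive (sym (contractRank-≡ R X I))))))
    (λ pt → ≤-trans (+-monoˡ-≤ (r X) (Equivalence.from (family-transversal family I) pt))
      (≤-reflexive (contractRank-≡ R X I)))

-- Matroids

module _ {n : ℕ} (M : Matroid n) where
  open Matroid M

  extend : ∀ {X I K} → I ⊆ X → Indep I → K ⊆ X → Indep K →
           ∃ λ J → I ⊆ J × J ⊆ X × Indep J × ∣ K ∣ ≤ ∣ J ∣
  extend {X} {I} {K} I⊆X indI K⊆X indK = go ∣ K ∣ I I⊆X indI (m≤n+m ∣ K ∣ ∣ I ∣)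
    where
    go : ∀ d I → I ⊆ X → Indep I → ∣ K ∣ ≤ ∣ I ∣ + d →
         ∃ λ J → I ⊆ J × J ⊆ X × Indep J × ∣ K ∣ ≤ ∣ J ∣
    go zero I I⊆X indI bound = I , id , I⊆X , indI , ≤-trans bound (≤-reflexive (+-identityʳ _))
    go (suc d) I I⊆X indI bound with ∣ I ∣ <? ∣ K ∣
    ... | no  ≮ = I , id , I⊆X , indI , ≮⇒≥ ≮
    ... | yes lt with augment indI indK lt
    ... | e , e∈K , e∉I , ind′ with go d (I ∪ ⁅ e ⁆) (∪-lub I⊆X (⁅⁆⊆ (K⊆X e∈K))) ind′
            (≤-trans bound (≤-reflexive (trans (+-suc ∣ I ∣ d) (cong (_+ d) (sym (x∉p⇒∣p∪⁅x⁆∣≡1+∣p∣ e∉I))))))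
    ... | J , I∪e⊆J , rest = J , I∪e⊆J ∘ ∪-inl , rest

  maximum : ∀ X → ∃ λ B → B ⊆ X × Indep B × (∀ J → J ⊆ X → Indep J → ∣ J ∣ ≤ ∣ B ∣)
  maximum X = go n ⊥ (⊥-elim ∘ ∉⊥) empty-indep (m≤n+m n ∣ ⊥ {n} ∣)
    where
    -- Every round replaces `B` by a larger independent set, so `n` rounds are enough.
    go : ∀ d B → B ⊆ X → Indep B → n ≤ ∣ B ∣ + d →
         ∃ λ B → B ⊆ X × Indep B × (∀ J → J ⊆ X → Indep J → ∣ J ∣ ≤ ∣ B ∣)
    go d B B⊆X indB bound with anySubset? (λ J → (J ⊆? X) ×-dec (Indep? J) ×-dec (∣ B ∣ <? ∣ J ∣))
    ... | no  none = B , B⊆X , indB , λ J J⊆X indJ → ≮⇒≥ λ lt → none (J , J⊆X , indJ , lt)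
    go zero B B⊆X indB bound | yes (J , _ , _ , lt) =
      contradiction (≤-trans (∣p∣≤n J) (≤-trans bound (≤-reflexive (+-identityʳ _)))) (<⇒≱ lt)
    go (suc d) B B⊆X indB bound | yes (J , J⊆X , indJ , lt) =
      go d J J⊆X indJ (≤-trans bound (≤-trans (≤-reflexive (+-suc ∣ B ∣ d)) (+-monoˡ-≤ d lt)))

  rank : Subset n → ℕ
  rank X = ∣ proj₁ (maximum X) ∣

  basis : ∀ X → ∃ λ B → B ⊆ X × Indep B × ∣ B ∣ ≡ rank X
  basis X = let B , B⊆X , indB , _ = maximum X in B , B⊆X , indB , refl

  indep⇒∣∣≤rank : ∀ {X J} → J ⊆ X → Indep J → ∣ J ∣ ≤ rank X
  indep⇒∣∣≤rank {X} J⊆X indJ = proj₂ (proj₂ (proj₂ (maximum X))) _ J⊆X indJ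

  extend-basis : ∀ {X I} → I ⊆ X → Indep I → ∃ λ J → I ⊆ J × J ⊆ X × Indep J × rank X ≤ ∣ J ∣
  extend-basis {X} I⊆X indI = let B , B⊆X , indB , _ = basis X in extend I⊆X indI B⊆X indB

  rank-mono : ∀ {X Y} → X ⊆ Y → rank X ≤ rank Y
  rank-mono {X} X⊆Y = let B , B⊆X , indB , _ = basis X in indep⇒∣∣≤rank (X⊆Y ∘ B⊆X) indB

  -- Extend a basis `I` of `V` to a basis `J` of `A ∪ B`: the independent sets `J ∩ A` and `J ∩ B`
  -- cover `J`, and both contain `I`.
  rank-submod : ∀ {U V} A B → U ⊆ A ∪ B → V ⊆ A → V ⊆ B → rank U + rank V ≤ rank A + rank B
  rank-submod {U} {V} A B U⊆ V⊆A V⊆B with basis V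
  ... | I , I⊆V , indI , ∣I∣≡ with extend-basis (∪-inl {p = A} {q = B} ∘ V⊆A ∘ I⊆V) indI
  ... | J , I⊆J , J⊆ , indJ , rank≤ = begin
    rank U + rank V                                ≤⟨ +-monoˡ-≤ (rank V) (rank-mono U⊆) ⟩
    rank (A ∪ B) + rank V                          ≤⟨ +-mono-≤ rank≤ (≤-reflexive (sym ∣I∣≡)) ⟩
    ∣ J ∣ + ∣ I ∣                                  ≤⟨ +-mono-≤ (p⊆q⇒∣p∣≤∣q∣ J⊆∪) (p⊆q⇒∣p∣≤∣q∣ I⊆∩) ⟩
    ∣ JA ∪ JB ∣ + ∣ JA ∩ JB ∣                      ≡⟨ ∣p∪q∣+∣p∩q∣≡∣p∣+∣q∣ JA JB ⟩
    ∣ JA ∣ + ∣ JB ∣                                ≤⟨ +-mono-≤ (indep⇒∣∣≤rank ∩-prr (hereditary ∩-prl indJ))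
                                                               (indep⇒∣∣≤rank ∩-prr (hereditary ∩-prl indJ)) ⟩
    rank A + rank B                                ∎
    where
    open ≤-Reasoning
    JA JB : Subset n
    JA = J ∩ A
    JB = J ∩ B
    J⊆∪ : J ⊆ JA ∪ JB
    J⊆∪ x∈J = [ (λ x∈A → ∪-inl (x∈p∩q⁺ (x∈J , x∈A))) , (λ x∈B → ∪-inr (x∈p∩q⁺ (x∈J , x∈B))) ]′ (∪-split (J⊆ x∈J))
    I⊆∩ : I ⊆ JA ∩ JB
    I⊆∩ = ∩-glb (∩-glb I⊆J (V⊆A ∘ I⊆V)) (∩-glb I⊆J (V⊆B ∘ I⊆V))

  rankFunction : RankFunction n
  rankFunction = record
    { r      = rank
    ; mono   = rank-mono
    ; card   = λ X → p⊆q⇒∣p∣≤∣q∣ (proj₁ (proj₂ (maximum X)))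
    ; submod = rank-submod
    }

  open RankFunction rankFunction using (cl; cyc; ∈cl⁺; ∈cl⁻; ∈cyc⁺; ∈cyc⁻; cyc-mono; IsCyclicFlat)

  ∣∣≤rank⇒indep : ∀ {I} → ∣ I ∣ ≤ rank I → Indep I
  ∣∣≤rank⇒indep {I} le = let B , B⊆I , indB , _ = basis I in
    subst Indep (⊆∧∣∣≥⇒≡ B⊆I le) indB

  maxIn⇒∣∣≡rank : ∀ {X B} → MaxIn Indep X B → ∣ B ∣ ≡ rank X
  maxIn⇒∣∣≡rank (B⊆X , indB , max) with extend-basis B⊆X indB
  ... | J , B⊆J , J⊆X , indJ , rank≤ = ≤-antisym (indep⇒∣∣≤rank B⊆X indB)
    (≤-trans rank≤ (≤-reflexive (cong ∣_∣ (sym (max J J⊆X indJ B⊆J)))))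

  ∣∣≥rank⇒maxIn : ∀ {X B} → B ⊆ X → Indep B → rank X ≤ ∣ B ∣ → MaxIn Indep X B
  ∣∣≥rank⇒maxIn B⊆X indB rank≤ = B⊆X , indB , λ J J⊆X indJ B⊆J →
    ⊆∧∣∣≥⇒≡ B⊆J (≤-trans (indep⇒∣∣≤rank J⊆X indJ) rank≤)

  hasRank : ∀ X → HasRank M X (rank X)
  hasRank X = basis X , λ J J⊆X indJ → indep⇒∣∣≤rank J⊆X indJ

  hasRank-unique : ∀ {X k} → HasRank M X k → k ≡ rank X
  hasRank-unique {X} ((I , I⊆X , indI , refl) , max) =
    let B , B⊆X , indB , ∣B∣≡ = basis X in
    ≤-antisym (indep⇒∣∣≤rank I⊆X indI) (≤-trans (≤-reflexive (sym ∣B∣≡)) (max B B⊆X indB))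

  ∈cl⇔inClosure : ∀ {X e} → e ∈ cl X ⇔ InClosure M X e
  ∈cl⇔inClosure {X} {e} = mk⇔
    (λ e∈ k hr → subst (HasRank M (X ∪ ⁅ e ⁆))
      (trans (≤-antisym (∈cl⁻ e∈) (rank-mono ∪-inl)) (sym (hasRank-unique hr))) (hasRank (X ∪ ⁅ e ⁆)))
    (λ inCl → ∈cl⁺ (≤-reflexive (sym (hasRank-unique (inCl (rank X) (hasRank X))))))

  isCyclicFlat⇒cyclicFlat : ∀ {X} → IsCyclicFlat X → CyclicFlat M X
  isCyclicFlat⇒cyclicFlat {X} (flat , cyclic) =
    (λ e inCl → flat (Equivalence.from ∈cl⇔inClosure inCl)) , λ e (e∈X , inAll) →
      -- As `e` is no isthmus for the rank function, a basis of `X - e` is also maximal in `X`, and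
      -- it avoids `e`.
      let B , B⊆ , indB , ∣B∣≡ = basis (X - e)
          r≤ = proj₂ (∈cyc⁻ (cyclic e∈X))
      in x∈p-y⇒x≢y {p = X} (B⊆ (inAll B (∣∣≥rank⇒maxIn (p-x⊆p ∘ B⊆) indB
           (≤-trans r≤ (≤-reflexive (sym ∣B∣≡)))))) refl

  dependent⇒circuit : ∀ {D} → ¬ Indep D → ∃ λ C → C ⊆ D × Circuit M C
  dependent⇒circuit {D} dep = go ∣ D ∣ D ≤-refl dep
    where
    go : ∀ d D → ∣ D ∣ ≤ d → ¬ Indep D → ∃ λ C → C ⊆ D × Circuit M C
    go d D bound dep with any? (λ x → (x ∈? D) ×-dec ¬? (Indep? (D - x)))
    ... | no none = D , id , dep , λ D′ (D′⊆D , x , x∈D , x∉D′) →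
      hereditary (⊆- D′⊆D x∉D′) (decidable-stable (Indep? (D - x)) λ dep′ → none (x , x∈D , dep′))
    go zero D bound dep | yes (x , x∈D , _) =
      contradiction (≤-trans (≤-reflexive (sym (x∈p⇒∣p∣≡1+∣p-x∣ x∈D))) bound) λ ()
    go (suc d) D bound dep | yes (x , x∈D , dep′) =
      let C , C⊆ , circuit = go d (D - x)
            (≤-pred (≤-trans (≤-reflexive (sym (x∈p⇒∣p∣≡1+∣p-x∣ x∈D))) bound)) dep′
      in C , p-x⊆p ∘ C⊆ , circuit

  -- If `e` is in `cyc Y`, then adding `e` to a basis of `Y - e` exceeds the rank of `Y` and so
  -- creates a circuit, necessarily through `e`. Conversely a circuit minus `e` is independent and
  -- has the full rank of the circuit.
  ∈cyc⇔∈circuit : ∀ {Y e} → e ∈ cyc Y ⇔ ∃ λ C → Circuit M C × e ∈ C × C ⊆ Y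
  ∈cyc⇔∈circuit {Y} {e} = mk⇔ to from
    where
    to : e ∈ cyc Y → ∃ λ C → Circuit M C × e ∈ C × C ⊆ Y
    to e∈ with basis (Y - e)
    ... | I , I⊆ , indI , ∣I∣≡ with dependent⇒circuit {I ∪ ⁅ e ⁆} dep
      where
      open ≤-Reasoning
      dep : ¬ Indep (I ∪ ⁅ e ⁆)
      dep ind = <-irrefl refl (begin-strict
        rank (Y - e)      ≡⟨ ∣I∣≡ ⟨
        ∣ I ∣             <⟨ ≤-reflexive (sym (x∉p⇒∣p∪⁅x⁆∣≡1+∣p∣ λ e∈I → x∈p-y⇒x≢y {p = Y} (I⊆ e∈I) refl)) ⟩
        ∣ I ∪ ⁅ e ⁆ ∣     ≤⟨ indep⇒∣∣≤rank (∪-lub (p-x⊆p ∘ I⊆) (⁅⁆⊆ (proj₁ (∈cyc⁻ e∈)))) ind ⟩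
        rank Y            ≤⟨ proj₂ (∈cyc⁻ e∈) ⟩
        rank (Y - e)      ∎)
    ... | C , C⊆ , circuit@(depC , _) = C , circuit , e∈C
        , ∪-lub (p-x⊆p ∘ I⊆) (⁅⁆⊆ (proj₁ (∈cyc⁻ e∈))) ∘ C⊆
      where
      e∈C : e ∈ C
      e∈C with e ∈? C
      ... | yes z   = z
      ... | no  e∉C = ⊥-elim (depC (hereditary (λ x∈C → [ id , (λ x∈e →
              ⊥-elim (e∉C (subst (_∈ C) (x∈⁅y⁆⇒x≡y e x∈e) x∈C))) ]′ (∪-split (C⊆ x∈C))) indI))

    from : (∃ λ C → Circuit M C × e ∈ C × C ⊆ Y) → e ∈ cyc Y
    from (C , (dep , min) , e∈C , C⊆Y) = cyc-mono C⊆Y (∈cyc⁺ e∈C (begin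
      rank C          ≤⟨ ≤-pred (≤-trans (≰⇒> (dep ∘ ∣∣≤rank⇒indep)) (≤-reflexive (x∈p⇒∣p∣≡1+∣p-x∣ e∈C))) ⟩
      ∣ C - e ∣       ≤⟨ indep⇒∣∣≤rank id (min (C - e) (x∈p⇒p-x⊂p e∈C)) ⟩
      rank (C - e)    ∎))
      where open ≤-Reasoning

  isJoin-cl : ∀ A B → IsJoin M A B (cl (A ∪ B))
  isJoin-cl A B e = ∈cl⇔inClosure

  isMeet-cyc : ∀ A B → IsMeet M A B (cyc (A ∩ B))
  isMeet-cyc A B e = ∈cyc⇔∈circuit

-- Exchange from dimension two and distributivity

module _ {n : ℕ} (M : Matroid n) (dim : DimAtMost2 M)
  (distributive : ∀ (𝒜 : Pred (Subset n) 0ℓ) → Antichain M 𝒜 → DistributiveGen M 𝒜) where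
  open RankFunction (rankFunction M)
  private
    module C₁ = TotalOrder (proj₁ dim)
    module C₂ = TotalOrder (proj₁ (proj₂ dim))

    f : Subset n → C₁.Carrier
    f = proj₁ (proj₂ (proj₂ dim))

    g : Subset n → C₂.Carrier
    g = proj₁ (proj₂ (proj₂ (proj₂ dim)))

    embedding : ∀ {X Y} → IsCyclicFlat X → IsCyclicFlat Y → X ⊆ Y ⇔ (f X C₁.≤ f Y × g X C₂.≤ g Y)
    embedding {X} {Y} cfX cfY = proj₂ (proj₂ (proj₂ (proj₂ dim))) X Y
      (isCyclicFlat⇒cyclicFlat M cfX) (isCyclicFlat⇒cyclicFlat M cfY)

    -- The order conjugate to inclusion: in the plane with coordinates `f` and `g`, incomparable
    -- cyclic flats run from the upper left to the lower right.
    _≺_ : Subset n → Subset n → Set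
    X ≺ Y = f X C₁.≤ f Y × g Y C₂.≤ g X

    ≺-refl : ∀ {A} → A ≺ A
    ≺-refl = C₁.refl , C₂.refl

    ≺-trans : ∀ {A B C} → A ≺ B → B ≺ C → A ≺ C
    ≺-trans (fAB , gAB) (fBC , gBC) = C₁.trans fAB fBC , C₂.trans gBC gAB

    compare : ∀ {A B} → IsCyclicFlat A → IsCyclicFlat B → (A ⊆ B ⊎ B ⊆ A) ⊎ (A ≺ B ⊎ B ≺ A)
    compare {A} {B} cfA cfB with C₁.total (f A) (f B) | C₂.total (g A) (g B)
    ... | inj₁ fAB | inj₁ gAB = inj₁ (inj₁ (Equivalence.from (embedding cfA cfB) (fAB , gAB)))
    ... | inj₂ fBA | inj₂ gBA = inj₁ (inj₂ (Equivalence.from (embedding cfB cfA) (fBA , gBA)))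
    ... | inj₁ fAB | inj₂ gBA = inj₂ (inj₁ (fAB , gBA))
    ... | inj₂ fBA | inj₁ gAB = inj₂ (inj₂ (fBA , gAB))

    -- Of the coordinates of `C`, the first is at least that of `B` and the second at least that of
    -- `L`, and `W` is below both flats.
    between-below : ∀ {W B C L} → IsCyclicFlat W → IsCyclicFlat B → IsCyclicFlat C → IsCyclicFlat L →
      W ⊆ B → W ⊆ L → B ≺ C → C ≺ L → W ⊆ C
    between-below cfW cfB cfC cfL W⊆B W⊆L (fBC , _) (_ , gLC) = Equivalence.from (embedding cfW cfC)
      ( C₁.trans (proj₁ (Equivalence.to (embedding cfW cfB) W⊆B)) fBC
      , C₂.trans (proj₂ (Equivalence.to (embedding cfW cfL) W⊆L)) gLC )

    between-above : ∀ {J B C L} → IsCyclicFlat J → IsCyclicFlat B → IsCyclicFlat C → IsCyclicFlat L →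
      B ⊆ J → L ⊆ J → B ≺ C → C ≺ L → C ⊆ J
    between-above cfJ cfB cfC cfL B⊆J L⊆J (_ , gCB) (fCL , _) = Equivalence.from (embedding cfC cfJ)
      ( C₁.trans fCL (proj₁ (Equivalence.to (embedding cfL cfJ) L⊆J))
      , C₂.trans gCB (proj₂ (Equivalence.to (embedding cfB cfJ) B⊆J)) )

    distrib : ∀ {A B C} → IsCyclicFlat A → IsCyclicFlat B → IsCyclicFlat C →
      Incomparable A B → Incomparable B C → Incomparable A C →
      cyc (A ∩ cl (B ∪ C)) ≡ cl (cyc (A ∩ B) ∪ cyc (A ∩ C))
    distrib {A} {B} {C} cfA cfB cfC A∥B B∥C A∥C =
      distributive 𝒜 (cyclicFlats , incomparables) A B C
        (gen (inj₁ refl)) (gen (inj₂ (inj₁ refl))) (gen (inj₂ (inj₂ refl))) _ _ _ _ _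
        (isJoin-cl M B C) (isMeet-cyc M A (cl (B ∪ C))) (isMeet-cyc M A B) (isMeet-cyc M A C)
        (isJoin-cl M (cyc (A ∩ B)) (cyc (A ∩ C)))
      where
      𝒜 : Pred (Subset n) 0ℓ
      𝒜 X = X ≡ A ⊎ X ≡ B ⊎ X ≡ C

      cyclicFlats : ∀ X → 𝒜 X → CyclicFlat M X
      cyclicFlats X (inj₁ refl)        = isCyclicFlat⇒cyclicFlat M cfA
      cyclicFlats X (inj₂ (inj₁ refl)) = isCyclicFlat⇒cyclicFlat M cfB
      cyclicFlats X (inj₂ (inj₂ refl)) = isCyclicFlat⇒cyclicFlat M cfC

      incomparables : ∀ X Y → 𝒜 X → 𝒜 Y → X ⊆ Y → X ≡ Y
      incomparables X Y (inj₁ refl)        (inj₁ refl)        _ = refl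
      incomparables X Y (inj₂ (inj₁ refl)) (inj₂ (inj₁ refl)) _ = refl
      incomparables X Y (inj₂ (inj₂ refl)) (inj₂ (inj₂ refl)) _ = refl
      incomparables X Y (inj₁ refl)        (inj₂ (inj₁ refl)) ⊆ = ⊥-elim (proj₁ A∥B ⊆)
      incomparables X Y (inj₁ refl)        (inj₂ (inj₂ refl)) ⊆ = ⊥-elim (proj₁ A∥C ⊆)
      incomparables X Y (inj₂ (inj₁ refl)) (inj₁ refl)        ⊆ = ⊥-elim (proj₂ A∥B ⊆)
      incomparables X Y (inj₂ (inj₁ refl)) (inj₂ (inj₂ refl)) ⊆ = ⊥-elim (proj₁ B∥C ⊆)
      incomparables X Y (inj₂ (inj₂ refl)) (inj₁ refl)        ⊆ = ⊥-elim (proj₂ A∥C ⊆)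
      incomparables X Y (inj₂ (inj₂ refl)) (inj₂ (inj₁ refl)) ⊆ = ⊥-elim (proj₂ B∥C ⊆)

    flip∥ : ∀ {A B : Subset n} → Incomparable A B → Incomparable B A
    flip∥ (A⊈B , B⊈A) = B⊈A , A⊈B

    meet-cyclicFlat : ∀ {A B} → IsCyclicFlat A → IsCyclicFlat B → IsCyclicFlat (cyc (A ∩ B))
    meet-cyclicFlat cfA cfB = cyc-cyclicFlat (∩-flat (proj₁ cfA) (proj₁ cfB))

    join-cyclicFlat : ∀ {A B} → IsCyclicFlat A → IsCyclicFlat B → IsCyclicFlat (cl (A ∪ B))
    join-cyclicFlat cfA cfB = cl-cyclicFlat (∪-cyclic (proj₂ cfA) (proj₂ cfB))

  -- B = B ∧ (A ∨ L) = (B ∧ A) ∨ (B ∧ L)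
  staircase : Staircase (rankFunction M)
  staircase = record
    { _≺_ = _≺_ ; ≺-refl = ≺-refl ; ≺-trans = ≺-trans ; compare = compare
    ; exchange = λ {A} {B} {L} cfA cfB cfL A≺B B≺L A∥B B∥L A∥L →
        cyc (B ∩ L)
      , (λ cfC → between-below (meet-cyclicFlat cfB cfL) cfB cfC cfL (∩-prl ∘ cyc⊆) (∩-prr ∘ cyc⊆))
      , cl-mono (∪-mono (∩-prr ∘ cyc⊆) id)
        ∘ subst (B ⊆_) (distrib cfB cfA cfL (flip∥ A∥B) A∥L B∥L)
            (cyc-mono (∩-glb id (between-above (join-cyclicFlat cfA cfL) cfA cfB cfL
                                   (⊆cl ∘ ∪-inl) (⊆cl ∘ ∪-inr) A≺B B≺L)) ∘ proj₂ cfB)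
    }

  -- The cyclic flats of the dual are the complements of those of M; there the exchange
  -- condition reads A ∧ (B ∨ L) = (A ∧ B) ∨ (A ∧ L) ⊆ B.
  dual-staircase : Staircase (dualRank (rankFunction M))
  dual-staircase = record
    { _≺_ = λ A B → ∁ A ≺ ∁ B ; ≺-refl = ≺-refl ; ≺-trans = ≺-trans
    ; compare = compare* ; exchange = exchange* }
    where
    module R* = RankFunction (dualRank (rankFunction M))

    co : ∀ {A} → R*.IsCyclicFlat A → IsCyclicFlat (∁ A)
    co = dual-cyclicFlat (rankFunction M)

    compare* : ∀ {A B} → R*.IsCyclicFlat A → R*.IsCyclicFlat B →
               (A ⊆ B ⊎ B ⊆ A) ⊎ (∁ A ≺ ∁ B ⊎ ∁ B ≺ ∁ A)
    compare* cfA cfB with compare (co cfA) (co cfB)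
    ... | inj₁ (inj₁ ∁A⊆∁B) = inj₁ (inj₂ (∁p⊆∁q⇒p⊇q ∁A⊆∁B))
    ... | inj₁ (inj₂ ∁B⊆∁A) = inj₁ (inj₁ (∁p⊆∁q⇒p⊇q ∁B⊆∁A))
    ... | inj₂ A≺≻B         = inj₂ A≺≻B

    exchange* : ∀ {A B L} → R*.IsCyclicFlat A → R*.IsCyclicFlat B → R*.IsCyclicFlat L →
      ∁ A ≺ ∁ B → ∁ B ≺ ∁ L → Incomparable A B → Incomparable B L → Incomparable A L →
      ∃ λ W → (∀ {C} → R*.IsCyclicFlat C → ∁ B ≺ ∁ C → ∁ C ≺ ∁ L → W ⊆ C) × B ⊆ R*.cl (A ∪ W)
    exchange* {A} {B} {L} cfA cfB cfL A≺B B≺L A∥B B∥L A∥L = W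
      , (λ cfC B≺C C≺L x∈W → x∉∁p⇒x∈p λ x∈∁C → x∈∁p⇒x∉p x∈W
          (between-above (join-cyclicFlat (co cfB) (co cfL)) (co cfB) (co cfC) (co cfL)
            (⊆cl ∘ ∪-inl) (⊆cl ∘ ∪-inr) B≺C C≺L x∈∁C))
      -- An element outside the dual closure of `A ∪ W` lies in the cyclic part of the complement,
      -- which is the meet of `∁ A` with the join of `∁ B` and `∁ L`.
      , λ e∈B → ∉cyc-∁⇒∈dual-cl (rankFunction M) λ e∈cyc → x∈∁p⇒x∉p (cyc⊆∁B e∈cyc) e∈B
      where
      W : Subset n
      -- The meet of `B` and `L` among the cyclic flats of the dual: the complement of the join of
      -- their complements.
      W = ∁ (cl (∁ B ∪ ∁ L))

      cyc⊆∁B : cyc (∁ (A ∪ W)) ⊆ ∁ B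
      cyc⊆∁B = cl-least
          (∪-lub (∩-prr ∘ cyc⊆) (between-below (meet-cyclicFlat (co cfA) (co cfL)) (co cfA) (co cfB) (co cfL)
                                  (∩-prl ∘ cyc⊆) (∩-prr ∘ cyc⊆) A≺B B≺L))
          (proj₁ (co cfB))
        ∘ ⊆-reflexive (distrib (co cfA) (co cfB) (co cfL)
            (∁-incomparable A∥B) (∁-incomparable B∥L) (∁-incomparable A∥L))
        ∘ cyc-mono (∩-glb (∁-anti ∪-inl) λ z → x∉∁p⇒x∈p (x∈∁p⇒x∉p (∁-anti {p = W} ∪-inr z)))

-- Minors and their duals

staircase⇒transversal : ∀ {n} (S : SetSystem n) {R : RankFunction n} → Staircase R → ∀ X →
  (let open RankFunction R in ∀ I → indep S I ⇔ (I ⊆ ground S × ∣ I ∣ + r X ≤ r (I ∪ X))) →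
  Transversal S
staircase⇒transversal {n} S stairs X char = k , A′ , (λ i → ∩-prr) , λ I → mk⇔ (to I) (from I)
  where
  presentation = contraction-transversal stairs X
  k = proj₁ presentation

  A A′ : Fin k → Subset n
  A = proj₁ (proj₂ presentation)
  -- Deletion restricts each set of a presentation to the remaining elements.
  A′ i = A i ∩ ground S

  to : ∀ I → indep S I → I ⊆ ground S × PartialTransversal A′ I
  to I ind with Equivalence.to (char I) ind
  ... | I⊆ , le =
    let φ , into , inj = Equivalence.to (proj₂ (proj₂ presentation) I) le in
    I⊆ , φ , (λ e e∈I → x∈p∩q⁺ (into e e∈I , I⊆ e∈I)) , inj

  from : ∀ I → I ⊆ ground S × PartialTransversal A′ I → indep S I
  from I (I⊆ , φ , into , inj) = Equivalence.from (char I) (I⊆ , Equivalence.from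
    (proj₂ (proj₂ presentation) I) (φ , (λ e e∈I → ∩-prl (into e e∈I)) , inj))

module _ {n : ℕ} (M : Matroid n) (C D : Subset n) where
  open Matroid M using (Indep; hereditary)
  open RankFunction (rankFunction M)
  open ≤-Reasoning
  private
    R* = dualRank (rankFunction M)
    module R* = RankFunction R*

    E : Subset n
    E = ∁ (C ∪ D)

    E∌C : ∀ {x} → x ∈ E → x ∉ C
    E∌C x∈E = x∈∁p⇒x∉p x∈E ∘ ∪-inl

    E∌D : ∀ {x} → x ∈ E → x ∉ D
    E∌D x∈E = x∈∁p⇒x∉p x∈E ∘ ∪-inr

  -- Every maximal independent subset `B` of `C` has the rank of `C`, so it can be traded for `C` by
  -- submodularity, and the choice of `B` does not matter.
  minor-indep : ∀ I → indep (minor M C D) I ⇔ (I ⊆ E × ∣ I ∣ + r C ≤ r (I ∪ C))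
  minor-indep I = mk⇔ to from
    where
    to : indep (minor M C D) I → I ⊆ E × ∣ I ∣ + r C ≤ r (I ∪ C)
    to (I⊆E , B , max@(B⊆C , _) , ind) = I⊆E , (begin
      ∣ I ∣ + r C      ≡⟨ cong (∣ I ∣ +_) (maxIn⇒∣∣≡rank M max) ⟨
      ∣ I ∣ + ∣ B ∣    ≡⟨ ∣⊎∣ I B (λ x∈I x∈B → E∌C (I⊆E x∈I) (B⊆C x∈B)) ⟨
      ∣ I ∪ B ∣        ≤⟨ indep⇒∣∣≤rank M (∪-mono id B⊆C) ind ⟩
      r (I ∪ C)        ∎)

    from : I ⊆ E × ∣ I ∣ + r C ≤ r (I ∪ C) → indep (minor M C D) I
    from (I⊆E , le) with basis M C
    ... | B , B⊆C , indB , ∣B∣≡ = I⊆E , B , ∣∣≥rank⇒maxIn M B⊆C indB (≤-reflexive (sym ∣B∣≡))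
      , ∣∣≤rank⇒indep M (+-cancelʳ-≤ (r C) _ _ (begin
          ∣ I ∪ B ∣ + r C          ≤⟨ +-monoˡ-≤ (r C) (∣p∪q∣≤∣p∣+∣q∣ I B) ⟩
          ∣ I ∣ + ∣ B ∣ + r C      ≡⟨ shift ∣ I ∣ ∣ B ∣ (r C) ⟩
          ∣ I ∣ + r C + ∣ B ∣      ≤⟨ +-mono-≤ le (indep⇒∣∣≤rank M id indB) ⟩
          r (I ∪ C) + r B          ≤⟨ submod (I ∪ B) C (∪-mono ∪-inl id) ∪-inr B⊆C ⟩
          r (I ∪ B) + r C          ∎))
      where
      shift : ∀ a b c → a + b + c ≡ a + c + b
      shift = solve-∀

  module _ (disjoint : Empty (C ∩ D)) where
    private
      C⊆∁D : C ⊆ ∁ D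
      C⊆∁D x∈C = x∉p⇒x∈∁p λ x∈D → disjoint (_ , x∈p∩q⁺ (x∈C , x∈D))

      E⊆∁D : E ⊆ ∁ D
      E⊆∁D = ∁-anti ∪-inr

      ∁D⊆C∪E : ∁ D ⊆ C ∪ E
      ∁D⊆C∪E {x} x∈∁D with ∈-or-∈∁ x C
      ... | inj₁ x∈C  = ∪-inl x∈C
      ... | inj₂ x∈∁C = ∪-inr (x∉p⇒x∈∁p ([ x∈∁p⇒x∉p x∈∁C , x∈∁p⇒x∉p x∈∁D ]′ ∘ ∪-split))

      C⊆∁I∪D : ∀ {I} → I ⊆ E → C ⊆ ∁ (I ∪ D)
      C⊆∁I∪D I⊆E x∈C = x∉p⇒x∈∁p ([ (λ x∈I → E∌C (I⊆E x∈I) x∈C) , x∈∁p⇒x∉p (C⊆∁D x∈C) ]′ ∘ ∪-split)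

    -- An element of `E` outside the closure of `B ∪ C` could be added to the basis `B`; hence
    -- `B ∪ C` spans `C ∪ E`, which contains `∁ D`.
    minor-basis-rank : ∀ {B} → Basis (minor M C D) B → r (∁ D) ≤ r (B ∪ C)
    minor-basis-rank {B} (B⊆E , indB , max) = r-⊆cl (∪-lub (⊆cl ∘ ∪-inr) E⊆cl ∘ ∁D⊆C∪E)
      where
      E⊆cl : E ⊆ cl (B ∪ C)
      E⊆cl {e} e∈E with r ((B ∪ C) ∪ ⁅ e ⁆) ≤? r (B ∪ C)
      ... | yes le = ∈cl⁺ le
      ... | no  ≰  = ⊆cl (∪-inl (subst (e ∈_) (sym (max (B ∪ ⁅ e ⁆) B∪e⊆E ind′ ∪-inl)) (∪-inr (x∈⁅x⁆ e))))
        where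
        B∪e⊆E : B ∪ ⁅ e ⁆ ⊆ E
        B∪e⊆E = ∪-lub B⊆E (⁅⁆⊆ e∈E)
        ind′ : indep (minor M C D) (B ∪ ⁅ e ⁆)
        ind′ = Equivalence.from (minor-indep (B ∪ ⁅ e ⁆)) (B∪e⊆E , (begin
          ∣ B ∪ ⁅ e ⁆ ∣ + r C      ≤⟨ +-monoˡ-≤ (r C) (∣p∪⁅x⁆∣≤1+∣p∣ B e) ⟩
          suc (∣ B ∣ + r C)        ≤⟨ s≤s (proj₂ (Equivalence.to (minor-indep B) indB)) ⟩
          suc (r (B ∪ C))          ≤⟨ ≰⇒> ≰ ⟩
          r ((B ∪ C) ∪ ⁅ e ⁆)      ≤⟨ mono (∪-lub (∪-mono ∪-inl id) (∪-inl ∘ ∪-inr)) ⟩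
          r ((B ∪ ⁅ e ⁆) ∪ C)      ∎))

    -- Extend a basis of `C` to a basis `J` of `∁ (I ∪ D)`. By assumption `J` has the rank of `∁ D`,
    -- so removing `C` from it leaves a basis of the minor, disjoint from `I`.
    minor-basis-avoiding : ∀ {I} → I ⊆ E → r (∁ D) ≤ r (∁ (I ∪ D)) →
      ∃ λ B → Basis (minor M C D) B × Empty (I ∩ B)
    minor-basis-avoiding {I} I⊆E spans with basis M C
    ... | B₀ , B₀⊆C , indB₀ , ∣B₀∣≡ with extend-basis M (C⊆∁I∪D I⊆E ∘ B₀⊆C) indB₀
    ... | J , B₀⊆J , J⊆ , indJ , rank≤ = B , (B⊆E , indB , max) , λ (x , x∈) →
        x∈∁p⇒x∉p (J⊆ (p─q⊆p J C (∩-prr x∈))) (∪-inl (∩-prl x∈))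
      where
      B : Subset n
      B = J ─ C

      B⊆E : B ⊆ E
      B⊆E x∈B = x∉p⇒x∈∁p ([ x∈p─q⇒x∉q J C x∈B , x∈∁p⇒x∉p (J⊆ (p─q⊆p J C x∈B)) ∘ ∪-inr ]′ ∘ ∪-split)

      indB : indep (minor M C D) B
      indB = Equivalence.from (minor-indep B) (B⊆E , (begin
        ∣ B ∣ + r C            ≡⟨ +-comm ∣ B ∣ _ ⟩
        r C + ∣ B ∣            ≡⟨ cong (_+ ∣ B ∣) ∣B₀∣≡ ⟨
        ∣ B₀ ∣ + ∣ B ∣         ≤⟨ +-monoˡ-≤ ∣ B ∣ (p⊆q⇒∣p∣≤∣q∣ (∩-glb {p = J} {q = C} B₀⊆J B₀⊆C)) ⟩
        ∣ J ∩ C ∣ + ∣ B ∣      ≡⟨ ∣p∣≡∣p∩q∣+∣p─q∣ J C ⟨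
        ∣ J ∣                  ≤⟨ indep⇒∣∣≤rank M (∪-lub (∪-inr ∘ ∩-prr) ∪-inl ∘ ─∪-cover) indJ ⟩
        r (B ∪ C)              ∎))

      max : ∀ K → K ⊆ E → indep (minor M C D) K → B ⊆ K → B ≡ K
      max K K⊆E indK B⊆K = ⊆∧∣∣≥⇒≡ B⊆K (+-cancelʳ-≤ (r C) _ _ (begin
        ∣ K ∣ + r C            ≤⟨ proj₂ (Equivalence.to (minor-indep K) indK) ⟩
        r (K ∪ C)              ≤⟨ mono (∪-lub (E⊆∁D ∘ K⊆E) C⊆∁D) ⟩
        r (∁ D)                ≤⟨ spans ⟩
        r (∁ (I ∪ D))          ≤⟨ rank≤ ⟩
        ∣ J ∣                  ≡⟨ ∣p∣≡∣p∩q∣+∣p─q∣ J C ⟩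
        ∣ J ∩ C ∣ + ∣ B ∣      ≤⟨ +-monoˡ-≤ ∣ B ∣ (indep⇒∣∣≤rank M ∩-prr (hereditary ∩-prl indJ)) ⟩
        r C + ∣ B ∣            ≡⟨ +-comm (r C) _ ⟩
        ∣ B ∣ + r C            ∎))

    -- Expanding the dual rank: `I` can be removed from `∁ D` without loss of rank exactly when it
    -- is independent in the dual contracted by `D`.
    dual-rank-span : ∀ {I} → I ⊆ E → r (∁ D) ≤ r (∁ (I ∪ D)) ⇔ ∣ I ∣ + R*.r D ≤ R*.r (I ∪ D)
    dual-rank-span {I} I⊆E = mk⇔
      (λ le → +-cancelʳ-≤ (r ⊤) _ _ (begin
        ∣ I ∣ + R*.r D + r ⊤           ≡⟨ left ⟩
        ∣ I ∣ + ∣ D ∣ + r (∁ D)        ≤⟨ +-monoʳ-≤ (∣ I ∣ + ∣ D ∣) le ⟩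
        ∣ I ∣ + ∣ D ∣ + r (∁ (I ∪ D))  ≡⟨ right ⟩
        R*.r (I ∪ D) + r ⊤             ∎))
      (λ le → +-cancelˡ-≤ (∣ I ∣ + ∣ D ∣) _ _ (begin
        ∣ I ∣ + ∣ D ∣ + r (∁ D)        ≡⟨ left ⟨
        ∣ I ∣ + R*.r D + r ⊤           ≤⟨ +-monoˡ-≤ (r ⊤) le ⟩
        R*.r (I ∪ D) + r ⊤             ≡⟨ right ⟨
        ∣ I ∣ + ∣ D ∣ + r (∁ (I ∪ D))  ∎))
      where
      left : ∣ I ∣ + R*.r D + r ⊤ ≡ ∣ I ∣ + ∣ D ∣ + r (∁ D)
      left = trans (+-assoc ∣ I ∣ _ _)
        (trans (cong (∣ I ∣ +_) (dualRank-≡ (rankFunction M) D)) (sym (+-assoc ∣ I ∣ _ _)))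
      right : ∣ I ∣ + ∣ D ∣ + r (∁ (I ∪ D)) ≡ R*.r (I ∪ D) + r ⊤
      right = sym (trans (dualRank-≡ (rankFunction M) (I ∪ D))
        (cong (_+ r (∁ (I ∪ D))) (∣⊎∣ I D (λ x∈I → E∌D (I⊆E x∈I)))))

    -- Dualizing interchanges deletion and contraction, so the dual of the minor is a deletion of
    -- the dual contracted by `D`.
    dual-minor-indep : ∀ I → indep (dual (minor M C D)) I ⇔ (I ⊆ E × ∣ I ∣ + R*.r D ≤ R*.r (I ∪ D))
    dual-minor-indep I = mk⇔
      (λ (I⊆E , B , basisB , I∩B=∅) → I⊆E , Equivalence.to (dual-rank-span I⊆E)
        (≤-trans (minor-basis-rank basisB) (mono (∪-lub
          (λ x∈B → x∉p⇒x∈∁p ([ (λ x∈I → I∩B=∅ (_ , x∈p∩q⁺ (x∈I , x∈B)))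
                             , E∌D (proj₁ basisB x∈B) ]′ ∘ ∪-split))
          (C⊆∁I∪D I⊆E)))))
      (λ (I⊆E , le) → I⊆E , minor-basis-avoiding I⊆E (Equivalence.from (dual-rank-span I⊆E) le))

theorem3p1 : ∀ {n : ℕ} (M : Matroid n) →
    DimAtMost2 M →
    (∀ (𝒜 : Pred (Subset n) 0ℓ) → Antichain M 𝒜 → DistributiveGen M 𝒜) →
    ∀ (C D : Subset n) → Empty (C ∩ D) →
    Transversal (minor M C D) × Transversal (dual (minor M C D))
theorem3p1 M dim distributive C D disjoint =
    staircase⇒transversal (minor M C D) (staircase M dim distributive) C (minor-indep M C D)
  , staircase⇒transversal (dual (minor M C D)) (dual-staircase M dim distributive) D
      (dual-minor-indep M C D disjoint)
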